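{- Let $\mathcal{P}$ be a tight chiral polyhedron of type $\{p, q\}$ with $q$ odd, and let $\Gamma^+(\mathcal{P})=\langle\sigma_1,\sigma_2\rangle$ be its rotation group with its distinguished generators. Then $p$ is an even divisor of $2q$. Furthermore, if the subgroup $\langle \sigma_2 \rangle$ is core-free in $\Gamma^+(\mathcal{P})$, then $p = 2q$.
   Context: An (abstract) polyhedron is a partially ordered set whose elements have rank $0$ (vertices), $1$ (edges) or $2$ (faces), where two elements are incident if they are comparable, such that: every edge is incident to exactly two vertices and two faces; whenever a vertex is incident to a face there are exactly two edges incident to both; the incidence graph is connected; and for every vertex or face $F$, the subgraph of the incidence graph induced on the neighbours of $F$ is connected. A flag is a mutually incident triple (vertex, edge, face); $\Phi^i$ denotes the unique flag differing from $\Phi$ exactly in its rank-$i$ element. Type $\{p,q\}$: every face is incident to $p$ edges and every vertex to $q$ edges. The polyhedron is chiral if its flags split into two classes such that $\Phi$ and $\Phi^i$ always lie in different classes and the automorphism group is transitive on each class but not on all flags. For a chiral polyhedron with fixed base flag $\Phi$, $\sigma_1$ is the automorphism sending $\Phi$ to $(\Phi^1)^0$ and $\sigma_2$ the automorphism sending $\Phi$ to $(\Phi^2)^1$; the rotation group is $\Gamma^+(\mathcal{P})=\langle\sigma_1,\sigma_2\rangle$ (which for chiral $\mathcal P$ is the whole automorphism group). A polyhedron of type $\{p,q\}$ is tight if it has exactly $2pq$ flags. A subgroup $H$ of a group $G$ is core-free if the largest subgroup of $H$ normal in $G$ is trivial. -}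

module Defs where

open import Data.Bool using (Bool; true; false)
open import Data.Nat using (ℕ; zero; suc; _*_)
open import Data.Nat.Divisibility using (_∣_)
open import Data.Integer using (ℤ; +_; -[1+_])
open import Data.Fin using (Fin)
open import Data.Sum using (_⊎_; inj₁; inj₂)
open import Data.Product using (Σ; _×_; _,_; proj₁; proj₂)
open import Data.Unit using (⊤)
open import Data.Empty using (⊥)
open import Relation.Nullary using (¬_)
open import Relation.Binary.PropositionalEquality using (_≡_; _≢_; trans)
open import Relation.Binary.Construct.Closure.ReflexiveTransitive using (Star)
open import Function.Bundles using (_↔_; Inverse)
open import Function.Construct.Composition using (_↔-∘_)
open import Function.Construct.Identity using (↔-id)
open import Function.Construct.Symmetry using (↔-sym)

-- Ranked incidence structures with elements of rank 0 (V), 1 (E), 2 (F).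
-- The order relation is given by the covering relations vertex<edge and
-- edge<face (as Bool-valued, hence proof-irrelevant, relations); a vertex
-- is below a face iff it is below some edge below that face (transitivity;
-- the diamond condition forbids v<f without a common edge).

record Structure : Set₁ where
  field
    V E F : Set
    ve : V → E → Bool
    ef : E → F → Bool

  VF : V → F → Set
  VF v f = Σ E (λ e → (ve v e ≡ true) × (ef e f ≡ true))

  El : Set
  El = V ⊎ (E ⊎ F)

  Inc : El → El → Set
  Inc (inj₁ v)        (inj₂ (inj₁ e)) = ve v e ≡ true
  Inc (inj₂ (inj₁ e)) (inj₁ v)        = ve v e ≡ true
  Inc (inj₂ (inj₁ e)) (inj₂ (inj₂ f)) = ef e f ≡ true
  Inc (inj₂ (inj₂ f)) (inj₂ (inj₁ e)) = ef e f ≡ true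
  Inc (inj₁ v)        (inj₂ (inj₂ f)) = VF v f
  Inc (inj₂ (inj₂ f)) (inj₁ v)        = VF v f
  Inc _               _               = ⊥

  Connected : (El → Set) → Set
  Connected S = ∀ x y → S x → S y → Star (λ a b → S a × S b × Inc a b) x y

  Flag : Set
  Flag = Σ (V × E × F) (λ { (v , e , f) → (ve v e ≡ true) × (ef e f ≡ true) })

  fv : Flag → V
  fv ((v , _ , _) , _) = v
  fe : Flag → E
  fe ((_ , e , _) , _) = e
  ff : Flag → F
  ff ((_ , _ , f) , _) = f

  _≈F_ : Flag → Flag → Set
  Φ ≈F Ψ = (fv Φ ≡ fv Ψ) × (fe Φ ≡ fe Ψ) × (ff Φ ≡ ff Ψ)

  Adj : Fin 3 → Flag → Flag → Set
  Adj Fin.zero Φ Ψ = (fv Φ ≢ fv Ψ) × (fe Φ ≡ fe Ψ) × (ff Φ ≡ ff Ψ)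
  Adj (Fin.suc Fin.zero) Φ Ψ = (fv Φ ≡ fv Ψ) × (fe Φ ≢ fe Ψ) × (ff Φ ≡ ff Ψ)
  Adj (Fin.suc (Fin.suc Fin.zero)) Φ Ψ = (fv Φ ≡ fv Ψ) × (fe Φ ≡ fe Ψ) × (ff Φ ≢ ff Ψ)

  record Aut : Set where
    field
      aV : V ↔ V
      aE : E ↔ E
      aF : F ↔ F
      pres-ve : ∀ v e → ve (Inverse.to aV v) (Inverse.to aE e) ≡ ve v e
      pres-ef : ∀ e f → ef (Inverse.to aE e) (Inverse.to aF f) ≡ ef e f
      pres-ve⁻ : ∀ v e → ve (Inverse.from aV v) (Inverse.from aE e) ≡ ve v e
      pres-ef⁻ : ∀ e f → ef (Inverse.from aE e) (Inverse.from aF f) ≡ ef e f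
  open Aut public

  _≈A_ : Aut → Aut → Set
  α ≈A β = (∀ v → Inverse.to (aV α) v ≡ Inverse.to (aV β) v)
         × (∀ e → Inverse.to (aE α) e ≡ Inverse.to (aE β) e)
         × (∀ f → Inverse.to (aF α) f ≡ Inverse.to (aF β) f)

  idA : Aut
  idA = record { aV = ↔-id V ; aE = ↔-id E ; aF = ↔-id F
               ; pres-ve = λ _ _ → Relation.Binary.PropositionalEquality.refl
               ; pres-ef = λ _ _ → Relation.Binary.PropositionalEquality.refl
               ; pres-ve⁻ = λ _ _ → Relation.Binary.PropositionalEquality.refl
               ; pres-ef⁻ = λ _ _ → Relation.Binary.PropositionalEquality.refl }

  -- composition  α ∘A β  (first β, then α)
  _∘A_ : Aut → Aut → Aut
  α ∘A β = record
    { aV = aV α ↔-∘ aV β ; aE = aE α ↔-∘ aE β ; aF = aF α ↔-∘ aF β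
    ; pres-ve = λ v e → trans (pres-ve α _ _) (pres-ve β v e)
    ; pres-ef = λ e f → trans (pres-ef α _ _) (pres-ef β e f)
    ; pres-ve⁻ = λ v e → trans (pres-ve⁻ β _ _) (pres-ve⁻ α v e)
    ; pres-ef⁻ = λ e f → trans (pres-ef⁻ β _ _) (pres-ef⁻ α e f) }

  invA : Aut → Aut
  invA α = record
    { aV = ↔-sym (aV α) ; aE = ↔-sym (aE α) ; aF = ↔-sym (aF α)
    ; pres-ve = pres-ve⁻ α ; pres-ef = pres-ef⁻ α
    ; pres-ve⁻ = pres-ve α ; pres-ef⁻ = pres-ef α }

  act : Aut → Flag → Flag
  act α ((v , e , f) , p , q) =
    (Inverse.to (aV α) v , Inverse.to (aE α) e , Inverse.to (aF α) f)
    , trans (pres-ve α v e) p , trans (pres-ef α e f) q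

  powℕ : Aut → ℕ → Aut
  powℕ α zero = idA
  powℕ α (suc n) = α ∘A powℕ α n

  pow : Aut → ℤ → Aut
  pow α (+ n) = powℕ α n
  pow α -[1+ n ] = powℕ (invA α) (suc n)

  Cyclic : Aut → Aut → Set
  Cyclic σ α = Σ ℤ (λ k → α ≈A pow σ k)

  record IsNormalSubgroup (N : Aut → Set) : Set where
    field
      resp : ∀ α β → α ≈A β → N α → N β
      has-id : N idA
      closed-∘ : ∀ α β → N α → N β → N (α ∘A β)
      closed-inv : ∀ α → N α → N (invA α)
      normal : ∀ g α → N α → N ((g ∘A α) ∘A invA g)

  CoreFree : (Aut → Set) → Set₁
  CoreFree H = (N : Aut → Set) → IsNormalSubgroup N → (∀ α → N α → H α)
             → ∀ α → N α → α ≈A idA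

record Polyhedron : Set₁ where
  field
    structure : Structure
  open Structure structure public
  field
    edge-two-vertices : ∀ e → Σ V (λ v → ve v e ≡ true) ↔ Fin 2
    edge-two-faces    : ∀ e → Σ F (λ f → ef e f ≡ true) ↔ Fin 2
    diamond : ∀ v f → VF v f → Σ E (λ e → (ve v e ≡ true) × (ef e f ≡ true)) ↔ Fin 2
    connected : Connected (λ _ → ⊤)
    vertex-strongly-connected : ∀ v → Connected (Inc (inj₁ v))
    face-strongly-connected   : ∀ f → Connected (Inc (inj₂ (inj₂ f)))

module _ (P : Polyhedron) where
  open Polyhedron P

  HasType : ℕ → ℕ → Set
  HasType p q = (∀ f → Σ E (λ e → ef e f ≡ true) ↔ Fin p)
              × (∀ v → Σ E (λ e → ve v e ≡ true) ↔ Fin q)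

  Tight : ℕ → ℕ → Set
  Tight p q = Flag ↔ Fin (2 * p * q)

  Chiral : Set
  Chiral = Σ (Flag → Bool) λ c →
      (∀ i Φ Ψ → Adj i Φ Ψ → c Φ ≢ c Ψ)
    × (∀ Φ Ψ → c Φ ≡ c Ψ → Σ Aut (λ α → act α Φ ≈F Ψ))
    × ¬ (∀ Φ Ψ → Σ Aut (λ α → act α Φ ≈F Ψ))

  IsSigma1 : Flag → Aut → Set
  IsSigma1 Φ σ = Σ Flag λ Φ₁ → Σ Flag λ Φ₁₀ →
    Adj (Fin.suc Fin.zero) Φ Φ₁ × Adj Fin.zero Φ₁ Φ₁₀ × (act σ Φ ≈F Φ₁₀)

  IsSigma2 : Flag → Aut → Set
  IsSigma2 Φ σ = Σ Flag λ Φ₂ → Σ Flag λ Φ₂₁ →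
    Adj (Fin.suc (Fin.suc Fin.zero)) Φ Φ₂ × Adj (Fin.suc Fin.zero) Φ₂ Φ₂₁ × (act σ Φ ≈F Φ₂₁)

Odd : ℕ → Set
Odd q = ¬ (2 ∣ q)

{-# OPTIONS --safe #-}
-- The rotation group G of a tight polyhedron is an exact product ⟨x⟩⟨y⟩ of cyclic groups of
-- orders p and q with (yx)² = 1, because the 2pq flags are x^i y^j Φ and x^i y^j Φ². As q is odd
-- and yx acts without fixed points on the p cosets of ⟨y⟩, p is even.
--
-- Suppose first that ⟨y⟩ is core-free. If p < q, then ⟨y⟩ and its conjugate by x intersect
-- nontrivially (count cosets), and the intersection is normal since ⟨y⟩ is cyclic; so q < p, and by
-- the same argument the core ⟨x^k⟩ of ⟨x⟩ is nontrivial. It is even central: y acts on it as the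
-- involution yx does, but y has odd order. Let ⟨y^m⟩ be the core of ⟨y⟩ modulo ⟨x^k⟩. By induction
-- on p + q, applied to G modulo ⟨x^k, y^m⟩, we get k = 2m. Write y^m x = x x^{ka} y^{mt}. The
-- (q/m)-th power of this gives p ∣ kaq/m, and the (p/k)-th power gives 2q ∣ p, because ⟨y⟩ is
-- core-free. Induction in the quotient by ⟨x^{kg}, y^m⟩, where g = gcd(a, p/k), gives g = 1, so
-- that p ∣ kq/m = 2q. In general, p ∣ 2q follows by passing to the quotient by the core of ⟨y⟩.
module Submission where

open import Defs
open import Algebra.Bundles using (Monoid)
import Algebra.Properties.CommutativeMonoid.Sum as Sum
open import Data.Bool using (Bool; true; if_then_else_)
import Data.Bool.Properties as Bool
open import Data.Empty using (⊥-elim)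
open import Data.Fin using (Fin; toℕ; fromℕ<; punchOut; remQuot; combine)
open import Data.Fin.Permutation using (permutation)
open import Data.Fin.Properties as Fin using (toℕ<n; toℕ-fromℕ<; fromℕ<-injective; toℕ-injective; pigeonhole; injective⇒≤; any?; punchOut-injective; combine-remQuot)
import Data.Integer as ℤ
open import Data.Nat using (ℕ; zero; suc; _+_; _*_; _∸_; _<_; _≤_; pred; NonZero; _%_; _/_; s≤s; s≤s⁻¹; >-nonZero; ≢-nonZero; ≢-nonZero⁻¹)
import Data.Nat.Coprimality as Coprimality
open import Data.Nat.DivMod
open import Data.Nat.Divisibility
open import Data.Nat.GCD using (gcd; gcd[m,n]∣m; gcd[m,n]∣n; gcd[m,n]≢0)
open import Data.Nat.Properties
open import Data.Product using (Σ; _×_; _,_; proj₁; proj₂; ∃; ∃₂)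
open import Data.Sum using (_⊎_; inj₁; inj₂)
open import Data.Unit using (⊤; tt)
open import Function.Base using (_∘_)
open import Function.Bundles using (_↔_; Inverse)
open import Level using (0ℓ)
open import Relation.Binary.Construct.Closure.ReflexiveTransitive using (Star; _◅_)
open import Relation.Binary.Definitions using (tri<; tri≈; tri>)
open import Relation.Binary.PropositionalEquality as ≡ using (_≡_; _≢_)
import Relation.Binary.Reasoning.Setoid as SetoidReasoning
open import Relation.Nullary using (¬_; Dec; yes; no)
open import Relation.Nullary.Decidable using (does; dec-true; dec-false; map′)
open import Tactic.MonoidSolver using (solve)

-- Arithmetic: subgroups of ℤ/q and parity.

least : {P : ℕ → Set} → (∀ n → Dec (P n)) → ∀ n → P n → ∃ λ m → P m × (∀ k → k < m → ¬ P k)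
least {P} P? zero Pn = 0 , Pn , λ _ ()
least {P} P? (suc n) Pn with P? 0
... | yes P0 = 0 , P0 , λ _ ()
... | no ¬P0 with least (λ k → P? (suc k)) n Pn
...   | m , Pm , min = suc m , Pm , λ { zero _ → ¬P0 ; (suc k) (s≤s k<m) → min k k<m }

-- P is a subgroup of ℤ/q, pulled back to ℕ.
subgroup-generator : {P : ℕ → Set} → (∀ n → Dec (P n)) → ∀ q .{{_ : NonZero q}} → P q →
  (∀ a b → P a → P b → P (a + b)) → (∀ a c → P (a + c * q) → P a) →
  ∃ λ m → NonZero m × P m × (∀ n → P n → m ∣ n)
subgroup-generator {P} P? q Pq add period with least (λ n → P? (suc n)) (pred q) (≡.subst P (≡.sym (suc-pred q)) Pq)
... | m′ , Pm , min = m , _ , Pm , λ n Pn → m%n≡0⇒n∣m n m (zero-residue n Pn)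
  where
  m = suc m′
  P0 : P 0
  P0 = period 0 1 (≡.subst P (≡.sym (+-identityʳ q)) Pq)
  multiple : ∀ s → P (s * m)
  multiple zero = P0
  multiple (suc s) = add m (s * m) Pm (multiple s)
  -- Instead of subtracting `n / m` copies of `m`, `pred q` times as many are added; the results
  -- differ by a multiple of `q`.
  shift : ∀ n → n + (n / m * pred q) * m ≡ n % m + (n / m * m) * q
  shift n = let c = n / m in begin
    n + (c * pred q) * m                    ≡⟨ ≡.cong (_+ (c * pred q) * m) (m≡m%n+[m/n]*n n m) ⟩
    n % m + c * m + (c * pred q) * m        ≡⟨ +-assoc (n % m) (c * m) _ ⟩
    n % m + (c * m + (c * pred q) * m)      ≡⟨ ≡.cong (n % m +_) (*-distribʳ-+ m c (c * pred q)) ⟨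
    n % m + (c + c * pred q) * m            ≡⟨ ≡.cong (λ t → n % m + t * m) (*-suc c (pred q)) ⟨
    n % m + (c * suc (pred q)) * m          ≡⟨ ≡.cong (λ t → n % m + (c * t) * m) (suc-pred q) ⟩
    n % m + (c * q) * m                     ≡⟨ ≡.cong (n % m +_) (*-assoc c q m) ⟩
    n % m + c * (q * m)                     ≡⟨ ≡.cong (λ t → n % m + c * t) (*-comm q m) ⟩
    n % m + c * (m * q)                     ≡⟨ ≡.cong (n % m +_) (*-assoc c m q) ⟨
    n % m + (c * m) * q                     ∎
    where open ≡.≡-Reasoning
  Pn%m : ∀ n → P n → P (n % m)
  Pn%m n Pn = period (n % m) (n / m * m) (≡.subst P (shift n) (add n _ Pn (multiple (n / m * pred q))))
  zero-residue : ∀ n → P n → n % m ≡ 0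
  zero-residue n Pn with n % m | Pn%m n Pn | m%n<n n m
  ... | zero  | _  | _       = ≡.refl
  ... | suc r | Pr | s≤s r<m = ⊥-elim (min r r<m Pr)

odd⇒half : ∀ {q} → ¬ 2 ∣ q → ∃ λ s → suc q ≡ s * 2
odd⇒half {q} odd with q % 2 | m≡m%n+[m/n]*n q 2 | m%n<n q 2
... | 0 | eq | _ = ⊥-elim (odd (divides (q / 2) eq))
... | 1 | eq | _ = suc (q / 2) , ≡.cong suc eq
... | suc (suc _) | _ | s≤s (s≤s ())

-- In each orbit exactly one element lies below its image. Reindexing by `f` shows that as many
-- elements lie above their image as below it.
fixedPointFree-involution⇒even : ∀ {n} (f : Fin n → Fin n) → (∀ i → f (f i) ≡ i) → (∀ i → f i ≢ i) → 2 ∣ n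
fixedPointFree-involution⇒even {n} f inv free = divides (sum up) (begin
  n                              ≡⟨ length n ⟨
  sum {n} (λ _ → 1)              ≡⟨ sum-cong-≗ (λ i → ≡.sym (split i (f i) (free i))) ⟩
  sum (λ i → up i + χ (f i) i)   ≡⟨ ∑-distrib-+ up _ ⟩
  sum up + sum (λ i → χ (f i) i) ≡⟨ ≡.cong (sum up +_) (sum-cong-≗ (λ i → ≡.cong (χ (f i)) (≡.sym (inv i)))) ⟩
  sum up + sum (λ i → up (f i))  ≡⟨ ≡.cong (sum up +_) (sum-permute up (permutation f f inv inv)) ⟨
  sum up + sum up                ≡⟨ ≡.cong (sum up +_) (+-identityʳ (sum up)) ⟨
  2 * sum up                     ≡⟨ *-comm 2 (sum up) ⟩
  sum up * 2                     ∎)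
  where
  open Sum +-0-commutativeMonoid using (sum; sum-cong-≗; ∑-distrib-+; sum-permute)
  open ≡.≡-Reasoning
  χ : Fin n → Fin n → ℕ
  χ i j = if does (i Fin.<? j) then 1 else 0
  up : Fin n → ℕ
  up i = χ i (f i)
  split : ∀ i j → j ≢ i → χ i j + χ j i ≡ 1
  split i j j≢i with Fin.<-cmp i j
  ... | tri< i<j _ j≮i rewrite dec-true (i Fin.<? j) i<j | dec-false (j Fin.<? i) j≮i = ≡.refl
  ... | tri≈ _ i≡j _ = ⊥-elim (j≢i (≡.sym i≡j))
  ... | tri> i≮j _ j<i rewrite dec-false (i Fin.<? j) i≮j | dec-true (j Fin.<? i) j<i = ≡.refl
  length : ∀ n → sum {n} (λ _ → 1) ≡ n
  length zero = ≡.refl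
  length (suc n) = ≡.cong suc (length n)

-- Powers and elements of finite order in a monoid.

-- Unlike the multiples of Algebra.Properties.Monoid.Mult, these powers do not depend on the
-- equality of the monoid, so they are literally the same in a monoid and in its quotients.
power : {A : Set} → (A → A → A) → A → A → ℕ → A
power _∙_ e u zero = e
power _∙_ e u (suc n) = u ∙ power _∙_ e u n

module Powers (M : Monoid 0ℓ 0ℓ) where
  open Monoid M
  open SetoidReasoning setoid

  infixr 8 _^_
  _^_ : Carrier → ℕ → Carrier
  _^_ = power _∙_ ε

  ^-+ : ∀ u m n → u ^ (m + n) ≈ u ^ m ∙ u ^ n
  ^-+ u zero n = sym (identityˡ _)
  ^-+ u (suc m) n = trans (∙-congˡ (^-+ u m n)) (sym (assoc _ _ _))

  ^-congʳ : ∀ u {m n} → m ≡ n → u ^ m ≈ u ^ n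
  ^-congʳ u ≡.refl = refl

  ^-* : ∀ u m n → u ^ (m * n) ≈ (u ^ m) ^ n
  ^-* u m zero = ^-congʳ u (*-zeroʳ m)
  ^-* u m (suc n) = begin
    u ^ (m * suc n)          ≈⟨ ^-congʳ u (*-suc m n) ⟩
    u ^ (m + m * n)          ≈⟨ ^-+ u m (m * n) ⟩
    u ^ m ∙ u ^ (m * n)      ≈⟨ ∙-congˡ (^-* u m n) ⟩
    u ^ m ∙ (u ^ m) ^ n      ∎

  ^-cong : ∀ {u v} n → u ≈ v → u ^ n ≈ v ^ n
  ^-cong zero u≈v = refl
  ^-cong (suc n) u≈v = ∙-cong u≈v (^-cong n u≈v)

  ε^ : ∀ n → ε ^ n ≈ ε
  ε^ zero = refl
  ε^ (suc n) = trans (identityˡ _) (ε^ n)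

  ^-∣ : ∀ {u p n} → u ^ p ≈ ε → p ∣ n → u ^ n ≈ ε
  ^-∣ {u} {p} {n} uᵖ (divides c n≡cp) = begin
    u ^ n         ≈⟨ ^-congʳ u (≡.trans n≡cp (*-comm c p)) ⟩
    u ^ (p * c)   ≈⟨ ^-* u p c ⟩
    (u ^ p) ^ c   ≈⟨ ^-cong c uᵖ ⟩
    ε ^ c         ≈⟨ ε^ c ⟩
    ε             ∎

  ^-periodic : ∀ {u p} n c → u ^ p ≈ ε → u ^ (n + c * p) ≈ u ^ n
  ^-periodic {u} {p} n c uᵖ = begin
    u ^ (n + c * p)       ≈⟨ ^-+ u n (c * p) ⟩
    u ^ n ∙ u ^ (c * p)   ≈⟨ ∙-congˡ (^-∣ {u} uᵖ (n∣m*n c)) ⟩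
    u ^ n ∙ ε             ≈⟨ identityʳ _ ⟩
    u ^ n                 ∎

  ^-% : ∀ {u p} .{{_ : NonZero p}} n → u ^ p ≈ ε → u ^ n ≈ u ^ (n % p)
  ^-% {u} {p} n uᵖ = trans (^-congʳ u (m≡m%n+[m/n]*n n p)) (^-periodic (n % p) (n / p) uᵖ)

  -- The relation `u ∙ v ≈ v ∙ w` expresses v⁻¹uv = w without an inverse. Conjugation mostly takes
  -- this form below.
  slide : ∀ {u v w} n → u ∙ v ≈ v ∙ w → u ^ n ∙ v ≈ v ∙ w ^ n
  slide zero h = trans (identityˡ _) (sym (identityʳ _))
  slide {u} {v} {w} (suc n) h = begin
    (u ∙ u ^ n) ∙ v   ≈⟨ assoc _ _ _ ⟩
    u ∙ (u ^ n ∙ v)   ≈⟨ ∙-congˡ (slide n h) ⟩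
    u ∙ (v ∙ w ^ n)   ≈⟨ assoc _ _ _ ⟨
    (u ∙ v) ∙ w ^ n   ≈⟨ ∙-congʳ h ⟩
    (v ∙ w) ∙ w ^ n   ≈⟨ assoc _ _ _ ⟩
    v ∙ (w ∙ w ^ n)   ∎

  commute-^ : ∀ {u v} n → u ∙ v ≈ v ∙ u → u ∙ v ^ n ≈ v ^ n ∙ u
  commute-^ n h = sym (slide n (sym h))

  ^-distrib-∙ : ∀ {u v} n → u ∙ v ≈ v ∙ u → (u ∙ v) ^ n ≈ u ^ n ∙ v ^ n
  ^-distrib-∙ zero h = sym (identityˡ _)
  ^-distrib-∙ {u} {v} (suc n) h = begin
    (u ∙ v) ∙ (u ∙ v) ^ n       ≈⟨ ∙-congˡ (^-distrib-∙ n h) ⟩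
    (u ∙ v) ∙ (u ^ n ∙ v ^ n)   ≈⟨ solve M ⟩
    u ∙ (v ∙ u ^ n) ∙ v ^ n     ≈⟨ ∙-congʳ (∙-congˡ (commute-^ n (sym h))) ⟩
    u ∙ (u ^ n ∙ v) ∙ v ^ n     ≈⟨ solve M ⟩
    (u ∙ u ^ n) ∙ (v ∙ v ^ n)   ∎

  -- A monoid has no inverse operation; when `u ^ p` is trivial, multiplying exponents of `u` by
  -- `pred p` negates them.
  ^-inverse : ∀ {u p} .{{_ : NonZero p}} n → u ^ p ≈ ε → u ^ n ∙ u ^ (n * pred p) ≈ ε
  ^-inverse {u} {p} n uᵖ = trans (sym (^-+ u n (n * pred p)))
    (^-∣ {u} uᵖ (divides n (≡.trans (≡.sym (*-suc n (pred p))) (≡.cong (n *_) (suc-pred p)))))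

  ^-inverse′ : ∀ {u p} .{{_ : NonZero p}} n → u ^ p ≈ ε → u ^ (n * pred p) ∙ u ^ n ≈ ε
  ^-inverse′ {u} {p} n uᵖ = trans (sym (^-+ u (n * pred p) n))
    (trans (^-congʳ u (+-comm (n * pred p) n)) (trans (^-+ u n (n * pred p)) (^-inverse n uᵖ)))

  cancelˡ : ∀ {u′ u v w} → u′ ∙ u ≈ ε → u ∙ v ≈ u ∙ w → v ≈ w
  cancelˡ {u′} {u} {v} {w} inv eq = begin
    v              ≈⟨ identityˡ v ⟨
    ε ∙ v          ≈⟨ ∙-congʳ inv ⟨
    (u′ ∙ u) ∙ v   ≈⟨ assoc _ _ _ ⟩
    u′ ∙ (u ∙ v)   ≈⟨ ∙-congˡ eq ⟩
    u′ ∙ (u ∙ w)   ≈⟨ assoc _ _ _ ⟨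
    (u′ ∙ u) ∙ w   ≈⟨ ∙-congʳ inv ⟩
    ε ∙ w          ≈⟨ identityˡ w ⟩
    w              ∎

  cancelʳ : ∀ {u u′ v w} → u ∙ u′ ≈ ε → v ∙ u ≈ w ∙ u → v ≈ w
  cancelʳ {u} {u′} {v} {w} inv eq = begin
    v              ≈⟨ identityʳ v ⟨
    v ∙ ε          ≈⟨ ∙-congˡ inv ⟨
    v ∙ (u ∙ u′)   ≈⟨ assoc _ _ _ ⟨
    (v ∙ u) ∙ u′   ≈⟨ ∙-congʳ eq ⟩
    (w ∙ u) ∙ u′   ≈⟨ assoc _ _ _ ⟩
    w ∙ (u ∙ u′)   ≈⟨ ∙-congˡ inv ⟩
    w ∙ ε          ≈⟨ identityʳ w ⟩
    w              ∎

  inverse-swap : ∀ {u′ u v} → u′ ∙ u ≈ ε → u ∙ v ≈ ε → v ∙ u ≈ ε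
  inverse-swap {u′} {u} {v} inv eq = trans (∙-congʳ v≈u′) inv
    where
    v≈u′ : v ≈ u′
    v≈u′ = begin
      v              ≈⟨ identityˡ v ⟨
      ε ∙ v          ≈⟨ ∙-congʳ inv ⟨
      (u′ ∙ u) ∙ v   ≈⟨ assoc _ _ _ ⟩
      u′ ∙ (u ∙ v)   ≈⟨ ∙-congˡ eq ⟩
      u′ ∙ ε         ≈⟨ identityʳ u′ ⟩
      u′             ∎

  conjugate : ∀ {g g′ n n′} → g ∙ g′ ≈ ε → n ∙ g′ ≈ g′ ∙ n′ → (g ∙ n) ∙ g′ ≈ n′
  conjugate {g} {g′} {n} {n′} inv eq = begin
    (g ∙ n) ∙ g′    ≈⟨ assoc _ _ _ ⟩
    g ∙ (n ∙ g′)    ≈⟨ ∙-congˡ eq ⟩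
    g ∙ (g′ ∙ n′)   ≈⟨ assoc _ _ _ ⟨
    (g ∙ g′) ∙ n′   ≈⟨ ∙-congʳ inv ⟩
    ε ∙ n′          ≈⟨ identityˡ n′ ⟩
    n′              ∎

  -- For odd `q`, u = u^(q+1) = (u²)^((q+1)/2).
  odd-order⇒square-generates : ∀ {u q} → ¬ 2 ∣ q → u ^ q ≈ ε → ∃ λ s → u ≈ (u ∙ u) ^ s
  odd-order⇒square-generates {u} {q} odd u^q with odd⇒half odd
  ... | s , 1+q≡s2 = s , (begin
    u                  ≈⟨ identityʳ u ⟨
    u ∙ ε              ≈⟨ ∙-congˡ u^q ⟨
    u ^ suc q          ≈⟨ ^-congʳ u (≡.trans 1+q≡s2 (*-comm s 2)) ⟩
    u ^ (2 * s)        ≈⟨ ^-* u 2 s ⟩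
    (u ^ 2) ^ s        ≈⟨ ^-cong s (∙-congˡ (identityʳ u)) ⟩
    (u ∙ u) ^ s        ∎)

  -- Multiplying by x^(-k) on the left and by y^(-l) on the right gives x^(i-k) y^(j-l) = 1.
  normalForm-unique : ∀ {x y p q} .{{_ : NonZero p}} .{{_ : NonZero q}} → x ^ p ≈ ε → y ^ q ≈ ε →
    (∀ i j → x ^ i ∙ y ^ j ≈ ε → p ∣ i × q ∣ j) →
    ∀ i j k l → x ^ i ∙ y ^ j ≈ x ^ k ∙ y ^ l → i % p ≡ k % p × j % q ≡ l % q
  normalForm-unique {x} {y} {p} {q} xᵖ y^q indep i j k l eq =
    residue i k (proj₁ divs) ,
    residue j l (≡.subst (q ∣_) (+-comm j (l * pred q)) (proj₂ divs))
    where
    divs : p ∣ k * pred p + i × q ∣ j + l * pred q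
    divs = indep (k * pred p + i) (j + l * pred q) (begin
      x ^ (k * pred p + i) ∙ y ^ (j + l * pred q)
        ≈⟨ ∙-cong (^-+ x (k * pred p) i) (^-+ y j (l * pred q)) ⟩
      (x ^ (k * pred p) ∙ x ^ i) ∙ (y ^ j ∙ y ^ (l * pred q))
        ≈⟨ solve M ⟩
      x ^ (k * pred p) ∙ (x ^ i ∙ y ^ j) ∙ y ^ (l * pred q)
        ≈⟨ ∙-congʳ (∙-congˡ eq) ⟩
      x ^ (k * pred p) ∙ (x ^ k ∙ y ^ l) ∙ y ^ (l * pred q)
        ≈⟨ solve M ⟩
      (x ^ (k * pred p) ∙ x ^ k) ∙ (y ^ l ∙ y ^ (l * pred q))
        ≈⟨ ∙-cong (^-inverse′ k xᵖ) (^-inverse l y^q) ⟩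
      ε ∙ ε
        ≈⟨ identityˡ ε ⟩
      ε ∎)
    residue : ∀ {r} .{{_ : NonZero r}} a b → r ∣ b * pred r + a → a % r ≡ b % r
    residue {r} a b r∣ = ≡.trans (≡.sym ([m+kn]%n≡m%n a b r))
      (≡.trans (%-congˡ {o = r} a+br) (%-remove-+ʳ b r∣))
      where
      a+br : a + b * r ≡ b + (b * pred r + a)
      a+br = ≡.trans (+-comm a (b * r))
        (≡.trans (≡.cong (λ r → b * r + a) (≡.sym (suc-pred r)))
          (≡.trans (≡.cong (_+ a) (*-suc b (pred r))) (+-assoc b (b * pred r) a)))

-- Exact products of two cyclic groups.

-- `independent` says both that `x` and `y` have exact orders `p` and `q` and that ⟨x⟩ and ⟨y⟩ meet
-- trivially. For positive `p` and `q`, `generated` makes every element invertible, so the monoid is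
-- a group.
record TightPair (M : Monoid 0ℓ 0ℓ) (x y : Monoid.Carrier M) (p q : ℕ) : Set where
  open Monoid M
  open Powers M
  field
    xᵖ≈ε        : x ^ p ≈ ε
    y^q≈ε       : y ^ q ≈ ε
    involution  : (y ∙ x) ∙ (y ∙ x) ≈ ε
    generated   : ∀ g → ∃₂ λ i j → g ≈ x ^ i ∙ y ^ j
    independent : ∀ i j → x ^ i ∙ y ^ j ≈ ε → p ∣ i × q ∣ j

-- This lets each result about `y` be applied to `x`. For `generated′`, the inverse of `g` is
-- written as x^a y^b and inverted again.
TightPair-swap : ∀ {M x y p q} .{{_ : NonZero p}} .{{_ : NonZero q}} →
                 TightPair M x y p q → TightPair M y x q p
TightPair-swap {M} {x} {y} {p} {q} T = record
  { xᵖ≈ε = y^q≈ε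
  ; y^q≈ε = xᵖ≈ε
  ; involution = xy-involution
  ; generated = generated′
  ; independent = λ j i eq → let p∣i , q∣j = independent i j (inverse-swap (^-inverse′ j y^q≈ε) eq) in q∣j , p∣i
  }
  where
  open Monoid M
  open Powers M
  open TightPair T
  open SetoidReasoning setoid

  xy-involution : (x ∙ y) ∙ (x ∙ y) ≈ ε
  xy-involution = begin
    (x ∙ y) ∙ (x ∙ y)      ≈⟨ solve M ⟩
    (x ∙ (y ∙ x)) ∙ y      ≈⟨ inverse-swap y⁻¹ (trans (sym (assoc y x (y ∙ x))) involution) ⟩
    ε                      ∎
    where
    y⁻¹ : y ^ (1 * pred q) ∙ y ≈ ε
    y⁻¹ = trans (∙-congˡ (sym (identityʳ y))) (^-inverse′ 1 y^q≈ε)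

  inverse : ∀ i j → (x ^ i ∙ y ^ j) ∙ (y ^ (j * pred q) ∙ x ^ (i * pred p)) ≈ ε
  inverse i j = begin
    (x ^ i ∙ y ^ j) ∙ (y ^ (j * pred q) ∙ x ^ (i * pred p))  ≈⟨ solve M ⟩
    x ^ i ∙ (y ^ j ∙ y ^ (j * pred q)) ∙ x ^ (i * pred p)    ≈⟨ ∙-congʳ (∙-congˡ (^-inverse j y^q≈ε)) ⟩
    x ^ i ∙ ε ∙ x ^ (i * pred p)                             ≈⟨ ∙-congʳ (identityʳ _) ⟩
    x ^ i ∙ x ^ (i * pred p)                                 ≈⟨ ^-inverse i xᵖ≈ε ⟩
    ε                                                        ∎

  generated′ : ∀ g → ∃₂ λ j i → g ≈ y ^ j ∙ x ^ i
  generated′ g =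
    let i , j , g≈ = generated g
        h = y ^ (j * pred q) ∙ x ^ (i * pred p)
        a , b , h≈ = generated h
        g′ = y ^ (b * pred q) ∙ x ^ (a * pred p)
    in b * pred q , a * pred p , (begin
      g              ≈⟨ identityʳ g ⟨
      g ∙ ε          ≈⟨ ∙-congˡ (trans (∙-congʳ h≈) (inverse a b)) ⟨
      g ∙ (h ∙ g′)   ≈⟨ assoc _ _ _ ⟨
      (g ∙ h) ∙ g′   ≈⟨ ∙-congʳ (trans (∙-congʳ g≈) (inverse i j)) ⟩
      ε ∙ g′         ≈⟨ identityˡ g′ ⟩
      g′             ∎)

-- Subgroups of a finite cyclic group are determined by their orders. So once `x` conjugates y^n
-- into ⟨y⟩, it normalises ⟨y^n⟩; in a `TightPair` the condition therefore says that ⟨y⟩ is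
-- core-free.
TrivialCore : (M : Monoid 0ℓ 0ℓ) (x y : Monoid.Carrier M) (q : ℕ) → Set
TrivialCore M x y q = ∀ n b → y ^ n ∙ x ≈ x ∙ y ^ b → q ∣ n
  where
  open Monoid M
  open Powers M

module TightPairProperties {M x y p q} .{{_ : NonZero p}} .{{_ : NonZero q}} (T : TightPair M x y p q) where
  open Monoid M
  open Powers M
  open TightPair T
  open SetoidReasoning setoid

  unique : ∀ i j k l → x ^ i ∙ y ^ j ≈ x ^ k ∙ y ^ l → i % p ≡ k % p × j % q ≡ l % q
  unique = normalForm-unique xᵖ≈ε y^q≈ε independent

  y^j≈ε⇒q∣j : ∀ j → y ^ j ≈ ε → q ∣ j
  y^j≈ε⇒q∣j j eq = proj₂ (independent 0 j (trans (identityˡ _) eq))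

  x-cancelˡ : ∀ {g h} i → x ^ i ∙ g ≈ x ^ i ∙ h → g ≈ h
  x-cancelˡ i = cancelˡ (^-inverse′ i xᵖ≈ε)

  x-cancelˡ₁ : ∀ {g h} → x ∙ g ≈ x ∙ h → g ≈ h
  x-cancelˡ₁ eq = x-cancelˡ 1 (trans (∙-congʳ (identityʳ x)) (trans eq (∙-congʳ (sym (identityʳ x)))))

  record Core : Set where
    field
      m t : ℕ
      m≢0 : NonZero m
      m∣q : m ∣ q
      normal : y ^ m ∙ x ≈ x ∙ y ^ (m * t)
      largest : ∀ n b → y ^ n ∙ x ≈ x ∙ y ^ b → m ∣ n

  -- The exponents `n` for which `x` conjugates y^n into ⟨y⟩ form a subgroup of ℤ/q, and `m` is its
  -- generator.
  core : Core
  core with subgroup-generator Normal? q normal-q normal-+ normal-period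
    where
    Normal : ℕ → Set
    Normal n = ∃ λ b → y ^ n ∙ x ≈ x ∙ y ^ b
    -- By uniqueness of normal forms, the exponent of `x` in the normal form of `y ^ n ∙ x` has to
    -- be 1 modulo `p`.
    Normal? : ∀ n → Dec (Normal n)
    Normal? n with generated (y ^ n ∙ x)
    ... | i , j , eq with i % p ≟ 1 % p
    ...   | yes i≡1 = yes (j , trans eq (∙-congʳ (begin
        x ^ i          ≈⟨ ^-% i xᵖ≈ε ⟩
        x ^ (i % p)    ≈⟨ ^-congʳ x i≡1 ⟩
        x ^ (1 % p)    ≈⟨ ^-% 1 xᵖ≈ε ⟨
        x ^ 1          ≈⟨ identityʳ x ⟩
        x              ∎)))
    ...   | no i≢1 = no λ { (b , eq′) → i≢1 (proj₁ (unique i j 1 b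
        (trans (sym eq) (trans eq′ (∙-congʳ (sym (identityʳ x))))))) }
    normal-q : Normal q
    normal-q = 0 , trans (∙-congʳ y^q≈ε) (trans (identityˡ x) (sym (identityʳ x)))
    normal-+ : ∀ a b → Normal a → Normal b → Normal (a + b)
    normal-+ a b (c , eq) (d , eq′) = c + d , (begin
      y ^ (a + b) ∙ x          ≈⟨ ∙-congʳ (^-+ y a b) ⟩
      (y ^ a ∙ y ^ b) ∙ x      ≈⟨ assoc _ _ _ ⟩
      y ^ a ∙ (y ^ b ∙ x)      ≈⟨ ∙-congˡ eq′ ⟩
      y ^ a ∙ (x ∙ y ^ d)      ≈⟨ assoc _ _ _ ⟨
      (y ^ a ∙ x) ∙ y ^ d      ≈⟨ ∙-congʳ eq ⟩
      (x ∙ y ^ c) ∙ y ^ d      ≈⟨ assoc _ _ _ ⟩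
      x ∙ (y ^ c ∙ y ^ d)      ≈⟨ ∙-congˡ (^-+ y c d) ⟨
      x ∙ y ^ (c + d)          ∎)
    normal-period : ∀ a c → Normal (a + c * q) → Normal a
    normal-period a c (b , eq) = b , trans (∙-congʳ (sym (^-periodic a c y^q≈ε))) eq
  ... | m , m≢0 , (b , eq) , m∣ = record
    { m = m ; t = quotient m∣b ; m≢0 = m≢0 ; m∣q = m∣q
    ; normal = trans eq (∙-congˡ (^-congʳ y (m∣n⇒n≡m*quotient m∣b)))
    ; largest = λ n b eq → m∣ n (b , eq) }
    where
    m∣q : m ∣ q
    m∣q = m∣ q (0 , trans (∙-congʳ y^q≈ε) (trans (identityˡ x) (sym (identityʳ x))))
    s = quotient m∣q
    instance _ = quotient≢0 m∣q
    -- The (q/m)-th power of the relation makes y^(b·q/m) trivial, so that `q` divides b·q/m.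
    m∣b : m ∣ b
    m∣b = *-cancelʳ-∣ s (≡.subst (_∣ b * s) (m∣n⇒n≡m*quotient m∣q) (y^j≈ε⇒q∣j (b * s) (x-cancelˡ₁ (begin
      x ∙ y ^ (b * s)       ≈⟨ ∙-congˡ (^-* y b s) ⟩
      x ∙ (y ^ b) ^ s       ≈⟨ slide s eq ⟨
      (y ^ m) ^ s ∙ x       ≈⟨ ∙-congʳ (^-* y m s) ⟨
      y ^ (m * s) ∙ x       ≈⟨ ∙-congʳ (^-congʳ y (m∣n⇒n≡m*quotient m∣q)) ⟨
      y ^ q ∙ x             ≈⟨ ∙-congʳ y^q≈ε ⟩
      ε ∙ x                 ≈⟨ identityˡ x ⟩
      x                     ≈⟨ identityʳ x ⟨
      x ∙ ε                 ∎))))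

  -- There are only `q` cosets y^b⟨x⟩, so two of the `p` elements x^i y share one. The difference of
  -- their exponents is a `d` for which `y` conjugates x^d into ⟨x⟩.
  q<p⇒overlap : q < p → ∃₂ λ d e → 0 < d × d < p × x ^ d ∙ y ≈ y ∙ x ^ e
  q<p⇒overlap q<p =
    d , e , m<n⇒0<n∸m i<j , ≤-<-trans (m∸n≤m (toℕ j) (toℕ i)) (toℕ<n j) , x-cancelˡ (toℕ i) (begin
      x ^ toℕ i ∙ (x ^ d ∙ y)                        ≈⟨ assoc _ _ _ ⟨
      (x ^ toℕ i ∙ x ^ d) ∙ y                        ≈⟨ ∙-congʳ (^-+ x (toℕ i) d) ⟨
      x ^ (toℕ i + d) ∙ y                            ≈⟨ ∙-congʳ (^-congʳ x (m+[n∸m]≡n (<⇒≤ i<j))) ⟩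
      x ^ toℕ j ∙ y                                  ≈⟨ eq′ ⟩
      y ^ b′ ∙ x ^ a′                                ≈⟨ ∙-congʳ y^b ⟨
      y ^ b ∙ x ^ a′                                 ≈⟨ ∙-congˡ (identityˡ _) ⟨
      y ^ b ∙ (ε ∙ x ^ a′)                           ≈⟨ ∙-congˡ (∙-congʳ (^-inverse a xᵖ≈ε)) ⟨
      y ^ b ∙ ((x ^ a ∙ x ^ (a * pred p)) ∙ x ^ a′)  ≈⟨ solve M ⟩
      (y ^ b ∙ x ^ a) ∙ (x ^ (a * pred p) ∙ x ^ a′)  ≈⟨ ∙-cong eq (^-+ x (a * pred p) a′) ⟨
      (x ^ toℕ i ∙ y) ∙ x ^ e                        ≈⟨ assoc _ _ _ ⟩
      x ^ toℕ i ∙ (y ∙ x ^ e)                        ∎)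
    where
    form : (i : Fin p) → ∃₂ λ b a → x ^ toℕ i ∙ y ≈ y ^ b ∙ x ^ a
    form i = TightPair.generated (TightPair-swap T) (x ^ toℕ i ∙ y)
    collision = pigeonhole q<p (λ i → fromℕ< (m%n<n (proj₁ (form i)) q))
    i = proj₁ collision
    j = proj₁ (proj₂ collision)
    i<j = proj₁ (proj₂ (proj₂ collision))
    b = proj₁ (form i)
    a = proj₁ (proj₂ (form i))
    eq = proj₂ (proj₂ (form i))
    b′ = proj₁ (form j)
    a′ = proj₁ (proj₂ (form j))
    eq′ = proj₂ (proj₂ (form j))
    d = toℕ j ∸ toℕ i
    -- This is a′ - a modulo `p`.
    e = a * pred p + a′
    y^b : y ^ b ≈ y ^ b′
    y^b = begin
      y ^ b         ≈⟨ ^-% b y^q≈ε ⟩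
      y ^ (b % q)   ≈⟨ ^-congʳ y (fromℕ<-injective _ _ (m%n<n b q) (m%n<n b′ q) (proj₂ (proj₂ (proj₂ collision)))) ⟩
      y ^ (b′ % q)  ≈⟨ ^-% b′ y^q≈ε ⟨
      y ^ b′        ∎

  -- The involution yx shows that u = x^k commutes with y², which generates ⟨y⟩ as q is odd.
  normal⇒central : ¬ 2 ∣ q → ∀ k t → x ^ k ∙ y ≈ y ∙ x ^ (k * t) → x ^ k ∙ y ≈ y ∙ x ^ k
  normal⇒central odd k t eq with odd-order⇒square-generates odd y^q≈ε
  ... | s , y≈ = begin
    u ∙ y              ≈⟨ ∙-congˡ y≈ ⟩
    u ∙ (y ∙ y) ^ s    ≈⟨ commute-^ s u-y² ⟩
    (y ∙ y) ^ s ∙ u    ≈⟨ ∙-congʳ y≈ ⟨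
    y ∙ u              ∎
    where
    u = x ^ k
    uy : u ∙ y ≈ y ∙ u ^ t
    uy = trans eq (∙-congˡ (^-* x k t))
    ux : ∀ n → u ^ n ∙ x ≈ x ∙ u ^ n
    ux n = slide n (sym (commute-^ k refl))
    conj : u ∙ (y ∙ x) ≈ (y ∙ x) ∙ u ^ t
    conj = begin
      u ∙ (y ∙ x)      ≈⟨ assoc _ _ _ ⟨
      (u ∙ y) ∙ x      ≈⟨ ∙-congʳ uy ⟩
      (y ∙ u ^ t) ∙ x  ≈⟨ assoc _ _ _ ⟩
      y ∙ (u ^ t ∙ x)  ≈⟨ ∙-congˡ (ux t) ⟩
      y ∙ (x ∙ u ^ t)  ≈⟨ assoc _ _ _ ⟨
      (y ∙ x) ∙ u ^ t  ∎
    -- As `x` commutes with `u`, conjugation by yx raises `u` to the power `t`, just as conjugation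
    -- by `y` does; done twice, it is trivial.
    u≈uᵗᵗ : u ≈ (u ^ t) ^ t
    u≈uᵗᵗ = begin
      u                                ≈⟨ identityʳ u ⟨
      u ∙ ε                            ≈⟨ ∙-congˡ involution ⟨
      u ∙ ((y ∙ x) ∙ (y ∙ x))          ≈⟨ assoc _ _ _ ⟨
      (u ∙ (y ∙ x)) ∙ (y ∙ x)          ≈⟨ ∙-congʳ conj ⟩
      ((y ∙ x) ∙ u ^ t) ∙ (y ∙ x)      ≈⟨ assoc _ _ _ ⟩
      (y ∙ x) ∙ (u ^ t ∙ (y ∙ x))      ≈⟨ ∙-congˡ (slide t conj) ⟩
      (y ∙ x) ∙ ((y ∙ x) ∙ (u ^ t) ^ t) ≈⟨ assoc _ _ _ ⟨
      ((y ∙ x) ∙ (y ∙ x)) ∙ (u ^ t) ^ t ≈⟨ ∙-congʳ involution ⟩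
      ε ∙ (u ^ t) ^ t                  ≈⟨ identityˡ _ ⟩
      (u ^ t) ^ t                      ∎
    u-y² : u ∙ (y ∙ y) ≈ (y ∙ y) ∙ u
    u-y² = begin
      u ∙ (y ∙ y)              ≈⟨ assoc _ _ _ ⟨
      (u ∙ y) ∙ y              ≈⟨ ∙-congʳ uy ⟩
      (y ∙ u ^ t) ∙ y          ≈⟨ assoc _ _ _ ⟩
      y ∙ (u ^ t ∙ y)          ≈⟨ ∙-congˡ (slide t uy) ⟩
      y ∙ (y ∙ (u ^ t) ^ t)    ≈⟨ assoc _ _ _ ⟨
      (y ∙ y) ∙ (u ^ t) ^ t    ≈⟨ ∙-congˡ u≈uᵗᵗ ⟨
      (y ∙ y) ∙ u              ∎

  -- yx acts without fixed points on the p cosets of ⟨y⟩: a stabiliser is conjugate to ⟨y⟩, of odd order.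
  2∣p : ¬ 2 ∣ q → ¬ (y ∙ x ≈ ε) → 2 ∣ p
  2∣p odd yx≉ε = fixedPointFree-involution⇒even f f-involutive f-free
    where
    z = y ∙ x
    form : (i : Fin p) → ∃₂ λ k j → z ∙ x ^ toℕ i ≈ x ^ toℕ {p} k ∙ y ^ j
    form i with generated (z ∙ x ^ toℕ i)
    ... | k , j , eq = fromℕ< (m%n<n k p) , j , trans eq (∙-congʳ (trans (^-% k xᵖ≈ε)
                         (^-congʳ x (≡.sym (toℕ-fromℕ< (m%n<n k p))))))
    f : Fin p → Fin p
    f i = proj₁ (form i)
    f-involutive : ∀ i → f (f i) ≡ i
    f-involutive i = toℕ-injective (≡.trans (≡.sym (m<n⇒m%n≡m (toℕ<n l)))
      (≡.trans (proj₁ (unique (toℕ l) (j′ + j) (toℕ i) 0 two-steps)) (m<n⇒m%n≡m (toℕ<n i))))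
      where
      k = f i
      l = f k
      j = proj₁ (proj₂ (form i))
      j′ = proj₁ (proj₂ (form k))
      eq = proj₂ (proj₂ (form i))
      eq′ = proj₂ (proj₂ (form k))
      two-steps : x ^ toℕ l ∙ y ^ (j′ + j) ≈ x ^ toℕ i ∙ y ^ 0
      two-steps = begin
        x ^ toℕ l ∙ y ^ (j′ + j)         ≈⟨ ∙-congˡ (^-+ y j′ j) ⟩
        x ^ toℕ l ∙ (y ^ j′ ∙ y ^ j)     ≈⟨ assoc _ _ _ ⟨
        (x ^ toℕ l ∙ y ^ j′) ∙ y ^ j     ≈⟨ ∙-congʳ eq′ ⟨
        (z ∙ x ^ toℕ k) ∙ y ^ j          ≈⟨ assoc _ _ _ ⟩
        z ∙ (x ^ toℕ k ∙ y ^ j)          ≈⟨ ∙-congˡ eq ⟨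
        z ∙ (z ∙ x ^ toℕ i)              ≈⟨ assoc _ _ _ ⟨
        (z ∙ z) ∙ x ^ toℕ i              ≈⟨ ∙-congʳ involution ⟩
        ε ∙ x ^ toℕ i                    ≈⟨ identityˡ _ ⟩
        x ^ toℕ i                        ≈⟨ identityʳ _ ⟨
        x ^ toℕ i ∙ ε                    ∎
    f-free : ∀ i → f i ≢ i
    f-free i fi≡i with odd-order⇒square-generates odd (trans (sym (^-* y j q)) (^-∣ {y} y^q≈ε (n∣m*n j)))
      where j = proj₁ (proj₂ (form i))
    ... | s , u≈ = yx≉ε (cancelʳ (^-inverse (toℕ i) xᵖ≈ε) (begin
        z ∙ x ^ toℕ i           ≈⟨ eq ⟩
        x ^ toℕ i ∙ y ^ j       ≈⟨ ∙-congˡ (trans u≈ (trans (^-cong s u²) (ε^ s))) ⟩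
        x ^ toℕ i ∙ ε           ≈⟨ identityʳ _ ⟩
        x ^ toℕ i               ≈⟨ identityˡ _ ⟨
        ε ∙ x ^ toℕ i           ∎))
      where
      j = proj₁ (proj₂ (form i))
      eq : z ∙ x ^ toℕ i ≈ x ^ toℕ i ∙ y ^ j
      eq = trans (proj₂ (proj₂ (form i))) (∙-congʳ (^-congʳ x (≡.cong toℕ fi≡i)))
      -- `y ^ j` is conjugate to `z` by `x ^ toℕ i`, so its square is trivial too.
      u² : y ^ j ∙ y ^ j ≈ ε
      u² = x-cancelˡ (toℕ i) (begin
        x ^ toℕ i ∙ (y ^ j ∙ y ^ j)     ≈⟨ assoc _ _ _ ⟨
        (x ^ toℕ i ∙ y ^ j) ∙ y ^ j     ≈⟨ ∙-congʳ eq ⟨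
        (z ∙ x ^ toℕ i) ∙ y ^ j         ≈⟨ assoc _ _ _ ⟩
        z ∙ (x ^ toℕ i ∙ y ^ j)         ≈⟨ ∙-congˡ eq ⟨
        z ∙ (z ∙ x ^ toℕ i)             ≈⟨ assoc _ _ _ ⟨
        (z ∙ z) ∙ x ^ toℕ i             ≈⟨ ∙-congʳ involution ⟩
        ε ∙ x ^ toℕ i                   ≈⟨ identityˡ _ ⟩
        x ^ toℕ i                       ≈⟨ identityʳ _ ⟨
        x ^ toℕ i ∙ ε                   ∎)

  yx≉ε : q ≢ 1 → ¬ (y ∙ x ≈ ε)
  yx≉ε q≢1 yx≈ε = q≢1 (∣1⇒≡1 (proj₁ (TightPair.independent (TightPair-swap T) 1 1
    (trans (∙-cong (identityʳ y) (identityʳ x)) yx≈ε))))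

-- Parity excludes p = q. If p < q, counting cosets with the roles exchanged gives a y^d with 0 < d
-- < q that `x` conjugates into ⟨y⟩.
trivialCore⇒q<p : ∀ {M x y p q} .{{_ : NonZero p}} .{{_ : NonZero q}} → TightPair M x y p q →
  ¬ 2 ∣ q → 2 ∣ p → TrivialCore M x y q → q < p
trivialCore⇒q<p {p = p} {q} T odd even cf with <-cmp p q
... | tri> _ _ q<p = q<p
... | tri≈ _ ≡.refl _ = ⊥-elim (odd even)
... | tri< p<q _ _ =
  let d , e , 0<d , d<q , eq = TightPairProperties.q<p⇒overlap (TightPair-swap T) p<q
  in ⊥-elim (>⇒∤ {{>-nonZero 0<d}} d<q (cf d e eq))

-- Quotients by ⟨x^k, y^m⟩.

CentralPower : (M : Monoid 0ℓ 0ℓ) (x y : Monoid.Carrier M) (k : ℕ) → Set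
CentralPower M x y k = x ^ k ∙ y ≈ y ∙ x ^ k
  where
  open Monoid M
  open Powers M

-- With x^k central, this makes ⟨x^k⟩⟨y^m⟩ normal: x⁻¹ y^m x stays inside it.
NormalPowers : (M : Monoid 0ℓ 0ℓ) (x y : Monoid.Carrier M) (k m a t : ℕ) → Set
NormalPowers M x y k m a t = y ^ m ∙ x ≈ x ∙ (x ^ (k * a) ∙ y ^ (m * t))
  where
  open Monoid M
  open Powers M

module Quotient {M x y p q} .{{_ : NonZero p}} .{{_ : NonZero q}} (T : TightPair M x y p q) (k m a t : ℕ)
  (k∣p : k ∣ p) (m∣q : m ∣ q) (central : CentralPower M x y k) (normal : NormalPowers M x y k m a t) where
  open Monoid M
  open Powers M
  open TightPair T
  open TightPairProperties T
  open SetoidReasoning setoid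

  u = x ^ k
  w = y ^ m

  uw : u ∙ w ≈ w ∙ u
  uw = commute-^ m central

  uⁿwⁿ : ∀ b c → u ^ b ∙ w ^ c ≈ w ^ c ∙ u ^ b
  uⁿwⁿ b c = commute-^ c (slide b uw)

  N : ℕ → ℕ → Carrier
  N b c = u ^ b ∙ w ^ c

  N-∙ : ∀ b c b′ c′ → N b c ∙ N b′ c′ ≈ N (b + b′) (c + c′)
  N-∙ b c b′ c′ = begin
    (u ^ b ∙ w ^ c) ∙ (u ^ b′ ∙ w ^ c′)    ≈⟨ solve M ⟩
    u ^ b ∙ (w ^ c ∙ u ^ b′) ∙ w ^ c′      ≈⟨ ∙-congʳ (∙-congˡ (uⁿwⁿ b′ c)) ⟨
    u ^ b ∙ (u ^ b′ ∙ w ^ c) ∙ w ^ c′      ≈⟨ solve M ⟩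
    (u ^ b ∙ u ^ b′) ∙ (w ^ c ∙ w ^ c′)    ≈⟨ ∙-cong (^-+ u b b′) (^-+ w c c′) ⟨
    N (b + b′) (c + c′)                    ∎

  N-inverse : ∀ b c → N b c ∙ N (b * pred p) (c * pred q) ≈ ε
  N-inverse b c = begin
    (u ^ b ∙ w ^ c) ∙ (u ^ (b * pred p) ∙ w ^ (c * pred q))   ≈⟨ N-∙ b c (b * pred p) (c * pred q) ⟩
    u ^ (b + b * pred p) ∙ w ^ (c + c * pred q)               ≈⟨ ∙-cong (^-+ u b _) (^-+ w c _) ⟩
    (u ^ b ∙ u ^ (b * pred p)) ∙ (w ^ c ∙ w ^ (c * pred q))   ≈⟨ ∙-cong (^-inverse b uᵖ) (^-inverse c w^q) ⟩
    ε ∙ ε                                                     ≈⟨ identityˡ ε ⟩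
    ε                                                         ∎
    where
    uᵖ : u ^ p ≈ ε
    uᵖ = trans (sym (^-* x k p)) (^-∣ {x} xᵖ≈ε (n∣m*n k))
    w^q : w ^ q ≈ ε
    w^q = trans (sym (^-* y m q)) (^-∣ {y} y^q≈ε (n∣m*n m))

  -- Conjugation by `g` maps the subgroup of all `N b c` into itself. The property passes to
  -- products, so it has to be checked for `x` and `y` only.
  Slides : Carrier → Set
  Slides g = ∀ b c → ∃₂ λ b′ c′ → N b c ∙ g ≈ g ∙ N b′ c′

  slides-∙ : ∀ {g h} → Slides g → Slides h → Slides (g ∙ h)
  slides-∙ {g} {h} sg sh b c =
    let b′ , c′ , eq = sg b c
        b″ , c″ , eq′ = sh b′ c′
    in b″ , c″ , (begin
      N b c ∙ (g ∙ h)       ≈⟨ assoc _ _ _ ⟨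
      (N b c ∙ g) ∙ h       ≈⟨ ∙-congʳ eq ⟩
      (g ∙ N b′ c′) ∙ h     ≈⟨ assoc _ _ _ ⟩
      g ∙ (N b′ c′ ∙ h)     ≈⟨ ∙-congˡ eq′ ⟩
      g ∙ (h ∙ N b″ c″)     ≈⟨ assoc _ _ _ ⟨
      (g ∙ h) ∙ N b″ c″     ∎)

  slides-^ : ∀ {g} n → Slides g → Slides (g ^ n)
  slides-^ zero sg b c = b , c , trans (identityʳ _) (sym (identityˡ _))
  slides-^ (suc n) sg = slides-∙ sg (slides-^ n sg)

  slides-y : Slides y
  slides-y b c = b , c , (begin
    (u ^ b ∙ w ^ c) ∙ y   ≈⟨ assoc _ _ _ ⟩
    u ^ b ∙ (w ^ c ∙ y)   ≈⟨ ∙-congˡ (slide c (sym (commute-^ m refl))) ⟩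
    u ^ b ∙ (y ∙ w ^ c)   ≈⟨ assoc _ _ _ ⟨
    (u ^ b ∙ y) ∙ w ^ c   ≈⟨ ∙-congʳ (slide b central) ⟩
    (y ∙ u ^ b) ∙ w ^ c   ≈⟨ assoc _ _ _ ⟩
    y ∙ (u ^ b ∙ w ^ c)   ∎)

  slides-x : Slides x
  slides-x b c = b + a * c , t * c , (begin
    (u ^ b ∙ w ^ c) ∙ x                        ≈⟨ assoc _ _ _ ⟩
    u ^ b ∙ (w ^ c ∙ x)                        ≈⟨ ∙-congˡ (slide c wx) ⟩
    u ^ b ∙ (x ∙ (u ^ a ∙ w ^ t) ^ c)          ≈⟨ assoc _ _ _ ⟨
    (u ^ b ∙ x) ∙ (u ^ a ∙ w ^ t) ^ c          ≈⟨ ∙-cong (slide b (sym (commute-^ k refl))) (^-distrib-∙ c (uⁿwⁿ a t)) ⟩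
    (x ∙ u ^ b) ∙ ((u ^ a) ^ c ∙ (w ^ t) ^ c)  ≈⟨ ∙-congˡ (∙-cong (^-* u a c) (^-* w t c)) ⟨
    (x ∙ u ^ b) ∙ (u ^ (a * c) ∙ w ^ (t * c))  ≈⟨ solve M ⟩
    x ∙ ((u ^ b ∙ u ^ (a * c)) ∙ w ^ (t * c))  ≈⟨ ∙-congˡ (∙-congʳ (^-+ u b (a * c))) ⟨
    x ∙ N (b + a * c) (t * c)                  ∎)
    where
    wx : w ∙ x ≈ x ∙ (u ^ a ∙ w ^ t)
    wx = trans normal (∙-congˡ (∙-cong (^-* x k a) (^-* y m t)))

  slides : ∀ g → Slides g
  slides g b c =
    let i , j , g≈ = generated g
        b′ , c′ , eq = slides-∙ (slides-^ i slides-x) (slides-^ j slides-y) b c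
    in b′ , c′ , trans (∙-congˡ g≈) (trans eq (∙-congʳ (sym g≈)))

  infix 4 _~_
  -- Equality of left cosets. The quotient keeps carrier and multiplication and only coarsens
  -- equality, so `x`, `y` and their powers carry over unchanged.
  _~_ : Carrier → Carrier → Set
  g ~ h = ∃₂ λ b c → g ≈ h ∙ N b c

  ≈⇒~ : ∀ {g h} → g ≈ h → g ~ h
  ≈⇒~ g≈h = 0 , 0 , trans g≈h (sym (trans (∙-congˡ (identityˡ ε)) (identityʳ _)))

  M/N : Monoid 0ℓ 0ℓ
  M/N = record
    { Carrier = Carrier ; _≈_ = _~_ ; _∙_ = _∙_ ; ε = ε
    ; isMonoid = record
      { isSemigroup = record
        { isMagma = record
          { isEquivalence = record { refl = ≈⇒~ refl ; sym = ~-sym ; trans = ~-trans }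
          ; ∙-cong = ~-cong }
        ; assoc = λ g h i → ≈⇒~ (assoc g h i) }
      ; identity = (λ g → ≈⇒~ (identityˡ g)) , (λ g → ≈⇒~ (identityʳ g)) } }
    where
    ~-sym : ∀ {g h} → g ~ h → h ~ g
    ~-sym {g} {h} (b , c , eq) = b * pred p , c * pred q , (begin
      h                        ≈⟨ identityʳ h ⟨
      h ∙ ε                    ≈⟨ ∙-congˡ (N-inverse b c) ⟨
      h ∙ (N b c ∙ N b′ c′)    ≈⟨ assoc _ _ _ ⟨
      (h ∙ N b c) ∙ N b′ c′    ≈⟨ ∙-congʳ eq ⟨
      g ∙ N b′ c′              ∎)
      where
      b′ = b * pred p
      c′ = c * pred q
    ~-trans : ∀ {g h i} → g ~ h → h ~ i → g ~ i
    ~-trans {g} {h} {i} (b , c , eq) (b′ , c′ , eq′) = b′ + b , c′ + c , (begin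
      g                        ≈⟨ eq ⟩
      h ∙ N b c                ≈⟨ ∙-congʳ eq′ ⟩
      (i ∙ N b′ c′) ∙ N b c    ≈⟨ assoc _ _ _ ⟩
      i ∙ (N b′ c′ ∙ N b c)    ≈⟨ ∙-congˡ (N-∙ b′ c′ b c) ⟩
      i ∙ N (b′ + b) (c′ + c)  ∎)
    ~-cong : ∀ {g g′ h h′} → g ~ g′ → h ~ h′ → g ∙ h ~ g′ ∙ h′
    ~-cong {g} {g′} {h} {h′} (b , c , eq) (b′ , c′ , eq′) =
      let d , e , eq″ = slides h′ b c
      in d + b′ , e + c′ , (begin
      g ∙ h                              ≈⟨ ∙-cong eq eq′ ⟩
      (g′ ∙ N b c) ∙ (h′ ∙ N b′ c′)      ≈⟨ assoc _ _ _ ⟩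
      g′ ∙ (N b c ∙ (h′ ∙ N b′ c′))      ≈⟨ ∙-congˡ (assoc _ _ _) ⟨
      g′ ∙ ((N b c ∙ h′) ∙ N b′ c′)      ≈⟨ ∙-congˡ (∙-congʳ eq″) ⟩
      g′ ∙ ((h′ ∙ N d e) ∙ N b′ c′)      ≈⟨ ∙-congˡ (assoc _ _ _) ⟩
      g′ ∙ (h′ ∙ (N d e ∙ N b′ c′))      ≈⟨ ∙-congˡ (∙-congˡ (N-∙ d e b′ c′)) ⟩
      g′ ∙ (h′ ∙ N (d + b′) (e + c′))    ≈⟨ assoc _ _ _ ⟨
      (g′ ∙ h′) ∙ N (d + b′) (e + c′)    ∎)

  N≈ : ∀ b c → N b c ≈ x ^ (k * b) ∙ y ^ (m * c)
  N≈ b c = sym (∙-cong (^-* x k b) (^-* y m c))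

  -- If x^i y^j equals some x^(kb) y^(mc), uniqueness of normal forms gives i ≡ kb modulo `p` and j
  -- ≡ mc modulo `q`; now `k ∣ p` and `m ∣ q` yield the divisibilities.
  quotient-tight : TightPair M/N x y k m
  quotient-tight = record
    { xᵖ≈ε = 1 , 0 , sym (trans (identityˡ _) (trans (identityʳ _) (identityʳ _)))
    ; y^q≈ε = 0 , 1 , sym (trans (identityˡ _) (trans (identityˡ _) (identityʳ _)))
    ; involution = ≈⇒~ involution
    ; generated = λ g → let i , j , eq = generated g in i , j , ≈⇒~ eq
    ; independent = λ { i j (b , c , eq) →
        let i≡ , j≡ = unique i j (k * b) (m * c) (trans eq (trans (identityˡ _) (N≈ b c)))
        in lift i k∣p (m∣m*n b) i≡ , lift j m∣q (m∣m*n c) j≡ }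
    }
    where
    lift : ∀ {d r n} .{{_ : NonZero r}} i → d ∣ r → d ∣ n → i % r ≡ n % r → d ∣ i
    lift i d∣r d∣n eq = ∣n∣m%n⇒∣m d∣r (≡.subst (_ ∣_) (≡.sym eq) (%-presˡ-∣ d∣n d∣r))

module CoreQuotient {M x y p q} .{{_ : NonZero p}} .{{_ : NonZero q}} (T : TightPair M x y p q)
  (C : TightPairProperties.Core T) where
  open Monoid M
  open Powers M
  open TightPair T
  open TightPairProperties.Core C
  -- With `p` in the place of `k`, the factor x^k is trivial and only the core of ⟨y⟩ is divided
  -- out.
  open Quotient T p m 0 t ∣-refl m∣q
    (trans (∙-congʳ xᵖ≈ε) (trans (identityˡ y) (trans (sym (identityʳ y)) (∙-congˡ (sym xᵖ≈ε)))))
    (trans normal (∙-congˡ (trans (sym (identityˡ _)) (∙-congʳ (^-congʳ x (≡.sym (*-zeroʳ p)))))))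
    public

-- The induction on p + q.

TwiceDivisor : ℕ → Set₁
TwiceDivisor n = ∀ {M x y p q} .{{_ : NonZero p}} .{{_ : NonZero q}} → p + q < n →
  ¬ 2 ∣ q → 2 ∣ p → TightPair M x y p q → p ∣ 2 * q × (TrivialCore M x y q → p ≡ 2 * q)

module Step {M x y p q} .{{_ : NonZero p}} .{{_ : NonZero q}} (T : TightPair M x y p q)
  (odd : ¬ 2 ∣ q) (even : 2 ∣ p) (IH : TwiceDivisor (p + q)) where
  open Monoid M
  open Powers M
  open TightPair T
  open TightPairProperties T
  open SetoidReasoning setoid

  module CentralCore (q≢1 : q ≢ 1) (cf : TrivialCore M x y q) (X : TightPairProperties.Core (TightPair-swap T)) where
    q<p : q < p
    q<p = trivialCore⇒q<p T odd even cf

    private module X = TightPairProperties.Core X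
    k = X.m
    k∣p = X.m∣q

    instance
      k≢0 : NonZero k
      k≢0 = X.m≢0

    -- Since q < p, some x^d with 0 < d < p is conjugated into ⟨x⟩ by `y`, and the core ⟨x^k⟩
    -- contains it.
    k<p : k < p
    k<p = let d , e , 0<d , d<p , eq = q<p⇒overlap q<p
          in ≤-<-trans (∣⇒≤ {{>-nonZero 0<d}} (X.largest d e eq)) d<p

    central : x ^ k ∙ y ≈ y ∙ x ^ k
    central = normal⇒central odd k X.t X.normal

    -- Taking `q` for `m` divides out ⟨x^k⟩ alone.
    module Q₁ = Quotient T k q 0 0 k∣p ∣-refl central
      (trans (∙-congʳ y^q≈ε) (trans (identityˡ x) (sym (trans
        (∙-congˡ (trans (∙-cong (^-congʳ x (*-zeroʳ k)) (^-congʳ y (*-zeroʳ q))) (identityˡ ε))) (identityʳ x)))))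

    T₁ : TightPair Q₁.M/N x y k q
    T₁ = Q₁.quotient-tight

    2∣k : 2 ∣ k
    2∣k = TightPairProperties.2∣p T₁ odd (TightPairProperties.yx≉ε T₁ q≢1)

    module CoreModX (Y : TightPairProperties.Core T₁) where
      private module Y = TightPairProperties.Core Y
      m = Y.m
      m∣q = Y.m∣q
      t = Y.t
      -- Equality in the quotient comes with witnesses: `a` is the exponent of x^k, and `c` that of
      -- the trivial element y^q.
      a = proj₁ Y.normal
      c = proj₁ (proj₂ Y.normal)

      instance
        m≢0 : NonZero m
        m≢0 = Y.m≢0

      N₁≈ : ∀ b c → Q₁.N b c ≈ x ^ (k * b)
      N₁≈ b c = trans (Q₁.N≈ b c) (trans (∙-congˡ (^-∣ {y} {q} {q * c} y^q≈ε (m∣m*n c))) (identityʳ _))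

      -- Modulo its core, ⟨x⟩ is core-free: a conjugate that lies in ⟨x⟩ modulo x^k lies in ⟨x⟩
      -- already.
      no-overlap₁ : ∀ d e → Monoid._≈_ Q₁.M/N (x ^ d ∙ y) (y ∙ x ^ e) → k ∣ d
      no-overlap₁ d e (b , c , eq) = X.largest d (e + k * b) (begin
        x ^ d ∙ y                         ≈⟨ eq ⟩
        (y ∙ x ^ e) ∙ Q₁.N b c            ≈⟨ ∙-congˡ (N₁≈ b c) ⟩
        (y ∙ x ^ e) ∙ x ^ (k * b)         ≈⟨ assoc _ _ _ ⟩
        y ∙ (x ^ e ∙ x ^ (k * b))         ≈⟨ ∙-congˡ (^-+ x e (k * b)) ⟨
        y ∙ x ^ (e + k * b)               ∎)

      -- If m = q, then ⟨y⟩ is core-free modulo x^k, hence q < k. Counting cosets there gives an x^d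
      -- with 0 < d < k that `y` conjugates into ⟨x⟩, against `no-overlap₁`.
      m<q : m < q
      m<q = ≤∧≢⇒< (∣⇒≤ m∣q) λ m≡q →
        let q<k = trivialCore⇒q<p T₁ odd 2∣k (λ n b eq → ≡.subst (_∣ n) m≡q (Y.largest n b eq))
            d , e , 0<d , d<k , eq = TightPairProperties.q<p⇒overlap T₁ q<k
        in >⇒∤ {{>-nonZero 0<d}} d<k (no-overlap₁ d e eq)

      xᵏ-y-commute : ∀ b c → x ^ (k * b) ∙ y ^ c ≈ y ^ c ∙ x ^ (k * b)
      xᵏ-y-commute b c = trans (∙-congʳ (^-* x k b))
        (trans (commute-^ c (slide b central)) (∙-congˡ (sym (^-* x k b))))

      normal : y ^ m ∙ x ≈ x ∙ (x ^ (k * a) ∙ y ^ (m * t))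
      normal = begin
        y ^ m ∙ x                              ≈⟨ proj₂ (proj₂ Y.normal) ⟩
        (x ∙ y ^ (m * t)) ∙ Q₁.N a c           ≈⟨ ∙-congˡ (N₁≈ a c) ⟩
        (x ∙ y ^ (m * t)) ∙ x ^ (k * a)        ≈⟨ assoc _ _ _ ⟩
        x ∙ (y ^ (m * t) ∙ x ^ (k * a))        ≈⟨ ∙-congˡ (xᵏ-y-commute a (m * t)) ⟨
        x ∙ (x ^ (k * a) ∙ y ^ (m * t))        ∎

      module Q₂ = Quotient T k m a t k∣p m∣q central normal

      -- Since y^m lies in ⟨y⟩, being conjugated into ⟨y⟩ modulo ⟨x^k, y^m⟩ is the same as modulo
      -- ⟨x^k⟩, where ⟨y^m⟩ is the core.
      trivialCore₂ : TrivialCore Q₂.M/N x y m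
      trivialCore₂ n b (b′ , d , eq) = Y.largest n (b + m * d) (b′ , 0 , (begin
        y ^ n ∙ x                                      ≈⟨ eq ⟩
        (x ∙ y ^ b) ∙ Q₂.N b′ d                         ≈⟨ ∙-congˡ (Q₂.N≈ b′ d) ⟩
        (x ∙ y ^ b) ∙ (x ^ (k * b′) ∙ y ^ (m * d))      ≈⟨ ∙-congˡ (xᵏ-y-commute b′ (m * d)) ⟩
        (x ∙ y ^ b) ∙ (y ^ (m * d) ∙ x ^ (k * b′))      ≈⟨ solve M ⟩
        (x ∙ (y ^ b ∙ y ^ (m * d))) ∙ x ^ (k * b′)      ≈⟨ ∙-cong (∙-congˡ (^-+ y b (m * d))) (N₁≈ b′ 0) ⟨
        (x ∙ y ^ (b + m * d)) ∙ Q₁.N b′ 0               ∎))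

      odd-m : ¬ 2 ∣ m
      odd-m 2∣m = odd (∣-trans 2∣m m∣q)

      k≡2m : k ≡ 2 * m
      k≡2m = proj₂ (IH (+-mono-<-≤ k<p (<⇒≤ m<q)) odd-m 2∣k Q₂.quotient-tight) trivialCore₂

      p′ = quotient k∣p
      s = quotient m∣q
      p≡kp′ = m∣n⇒n≡m*quotient k∣p
      q≡ms = m∣n⇒n≡m*quotient m∣q

      ks≡2q : k * s ≡ 2 * q
      ks≡2q = ≡.trans (≡.cong (_* s) k≡2m) (≡.trans (*-assoc 2 m s) (≡.cong (2 *_) (≡.sym q≡ms)))

      normal-^ : ∀ n → y ^ (m * n) ∙ x ≈ x ∙ (x ^ (k * a * n) ∙ y ^ (m * t * n))
      normal-^ n = begin
        y ^ (m * n) ∙ x                                    ≈⟨ ∙-congʳ (^-* y m n) ⟩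
        (y ^ m) ^ n ∙ x                                    ≈⟨ slide n normal ⟩
        x ∙ (x ^ (k * a) ∙ y ^ (m * t)) ^ n                ≈⟨ ∙-congˡ (^-distrib-∙ n (xᵏ-y-commute a (m * t))) ⟩
        x ∙ ((x ^ (k * a)) ^ n ∙ (y ^ (m * t)) ^ n)        ≈⟨ ∙-congˡ (∙-cong (^-* x (k * a) n) (^-* y (m * t) n)) ⟨
        x ∙ (x ^ (k * a * n) ∙ y ^ (m * t * n))            ∎

      -- For n = q/m, the left side of `normal-^` is y^q x = x, so x^(kas) y^(mts) = 1 and
      -- `independent` applies.
      p′∣as : p′ ∣ a * s
      p′∣as = *-cancelˡ-∣ k (≡.subst₂ _∣_ p≡kp′ (*-assoc k a s) (proj₁ (independent (k * a * s) (m * t * s) (x-cancelˡ₁ (begin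
        x ∙ (x ^ (k * a * s) ∙ y ^ (m * t * s))   ≈⟨ normal-^ s ⟨
        y ^ (m * s) ∙ x                           ≈⟨ ∙-congʳ (^-congʳ y q≡ms) ⟨
        y ^ q ∙ x                                 ≈⟨ ∙-congʳ y^q≈ε ⟩
        ε ∙ x                                     ≈⟨ identityˡ x ⟩
        x                                         ≈⟨ identityʳ x ⟨
        x ∙ ε                                     ∎)))))

      -- As kp′ = p, the p′-th power removes the factor x^(kap′). So `x` conjugates y^(mp′) into
      -- ⟨y⟩, whose core is trivial.
      q∣mp′ : q ∣ m * p′
      q∣mp′ = cf (m * p′) (m * t * p′) (begin
        y ^ (m * p′) ∙ x                          ≈⟨ normal-^ p′ ⟩
        x ∙ (x ^ (k * a * p′) ∙ y ^ (m * t * p′)) ≈⟨ ∙-congˡ (∙-congʳ (^-∣ {x} {p} {k * a * p′} xᵖ≈ε p∣kap′)) ⟩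
        x ∙ (ε ∙ y ^ (m * t * p′))                ≈⟨ ∙-congˡ (identityˡ _) ⟩
        x ∙ y ^ (m * t * p′)                      ∎)
        where
        p∣kap′ : p ∣ k * a * p′
        p∣kap′ = ≡.subst (_∣ k * a * p′) (≡.sym p≡kp′) (*-monoˡ-∣ p′ (m∣m*n {k} a))

      2q∣p : 2 * q ∣ p
      2q∣p = ≡.subst (2 * q ∣_) 2mp′≡p (*-monoʳ-∣ 2 q∣mp′)
        where
        2mp′≡p : 2 * (m * p′) ≡ p
        2mp′≡p = ≡.trans (≡.sym (*-assoc 2 m p′)) (≡.trans (≡.cong (_* p′) (≡.sym k≡2m)) (≡.sym p≡kp′))

      instance
        p′≢0 : NonZero p′
        p′≢0 = quotient≢0 k∣p

      g = gcd a p′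

      instance
        g≢0 : NonZero g
        g≢0 = ≢-nonZero (gcd[m,n]≢0 a p′ (inj₂ (≢-nonZero⁻¹ p′)))
        kg≢0 : NonZero (k * g)
        kg≢0 = m*n≢0 k g

      a′ = quotient (gcd[m,n]∣m a p′)

      kga′≡ka : k * g * a′ ≡ k * a
      kga′≡ka = ≡.trans (*-assoc k g a′) (≡.cong (k *_) (≡.sym (m∣n⇒n≡m*quotient (gcd[m,n]∣m a p′))))

      kg∣p : k * g ∣ p
      kg∣p = ≡.subst (k * g ∣_) (≡.sym p≡kp′) (*-monoʳ-∣ k (gcd[m,n]∣n a p′))

      -- Since `g` divides `a`, the conjugate x^(ka) y^(mt) of y^m still lies in ⟨x^(kg), y^m⟩.
      module Q₃ = Quotient T (k * g) m a′ t kg∣p m∣q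
        (trans (∙-congʳ (^-* x k g)) (trans (slide g central) (∙-congˡ (sym (^-* x k g)))))
        (trans normal (∙-congˡ (∙-congʳ (^-congʳ x (≡.sym kga′≡ka)))))

      -- Induction in this quotient gives kg ∣ 2m = k. It applies even if kg = p, because m < q.
      g≡1 : g ≡ 1
      g≡1 = ∣1⇒≡1 (*-cancelˡ-∣ k (≡.subst (k * g ∣_) (≡.trans (≡.sym k≡2m) (≡.sym (*-identityʳ k)))
        (proj₁ (IH (+-mono-≤-< (∣⇒≤ kg∣p) m<q) odd-m (∣m⇒∣m*n g 2∣k) Q₃.quotient-tight))))

      -- Being coprime to `a`, `p′` divides `s`; hence p = kp′ divides ks = 2q.
      p∣2q : p ∣ 2 * q
      p∣2q = ≡.subst₂ _∣_ (≡.sym p≡kp′) ks≡2q (*-monoʳ-∣ k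
        (Coprimality.coprime-divisor (Coprimality.sym (Coprimality.gcd≡1⇒coprime {a} {p′} g≡1)) p′∣as))

      p≡2q : p ≡ 2 * q
      p≡2q = ∣-antisym p∣2q 2q∣p

  -- Here `y` is trivial, so x² = (yx)² = 1. The case is separate because `2∣k` rests on q ≠ 1.
  q≡1⇒p≡2q : q ≡ 1 → p ≡ 2 * q
  q≡1⇒p≡2q ≡.refl = ∣-antisym (proj₁ (independent 2 0 x²≈ε)) even
    where
    y≈ε : y ≈ ε
    y≈ε = trans (sym (identityʳ y)) y^q≈ε
    x²≈ε : x ^ 2 ∙ ε ≈ ε
    x²≈ε = begin
      (x ∙ (x ∙ ε)) ∙ ε        ≈⟨ solve M ⟩
      (ε ∙ x) ∙ (ε ∙ x)        ≈⟨ ∙-cong (∙-congʳ y≈ε) (∙-congʳ y≈ε) ⟨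
      (y ∙ x) ∙ (y ∙ x)        ≈⟨ involution ⟩
      ε                        ∎

  trivialCore⇒p≡2q : TrivialCore M x y q → p ≡ 2 * q
  trivialCore⇒p≡2q cf with q ≟ 1
  ... | yes q≡1 = q≡1⇒p≡2q q≡1
  ... | no q≢1 = C.CoreModX.p≡2q (TightPairProperties.core C.T₁)
    where module C = CentralCore q≢1 cf (TightPairProperties.core (TightPair-swap T))

  -- The quotient by the core keeps `p` and replaces `q` by its divisor `m`, which lowers p + q
  -- unless the core is trivial.
  p∣2q-from : Core → p ∣ 2 * q
  p∣2q-from C with Core.m C ≟ q
  ... | yes m≡q = ∣-reflexive (trivialCore⇒p≡2q λ n b eq → ≡.subst (_∣ n) m≡q (Core.largest C n b eq))
  ... | no m≢q = ∣-trans
      (proj₁ (IH (+-monoʳ-< p (≤∧≢⇒< (∣⇒≤ m∣q) m≢q)) (λ 2∣m → odd (∣-trans 2∣m m∣q)) even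
        (CoreQuotient.quotient-tight T C)))
      (*-monoʳ-∣ 2 m∣q)
    where
    open Core C using (m; m∣q)
    instance
      m-nonZero : NonZero m
      m-nonZero = Core.m≢0 C

twiceDivisor : ∀ n → TwiceDivisor n
twiceDivisor (suc n) {p = p} {q = q} (s≤s p+q≤n) odd even T = 
  Step.p∣2q-from T odd even IH (TightPairProperties.core T) , Step.trivialCore⇒p≡2q T odd even IH
  where
  IH : TwiceDivisor (p + q)
  IH lt = twiceDivisor n (<-≤-trans lt p+q≤n)

-- The core as a normal subgroup.

record NormalSubgroupOf⟨_⟩ {M : Monoid 0ℓ 0ℓ} (y : Monoid.Carrier M) : Set₁ where
  open Monoid M
  open Powers M
  field
    Member : Carrier → Set
    resp : ∀ {g h} → g ≈ h → Member g → Member h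
    ε-closed : Member ε
    ∙-closed : ∀ {g h} → Member g → Member h → Member (g ∙ h)
    inverse-closed : ∀ {g g′} → g′ ∙ g ≈ ε → g ∙ g′ ≈ ε → Member g → Member g′
    conjugate-closed : ∀ {g g′ n} → g ∙ g′ ≈ ε → Member n → Member ((g ∙ n) ∙ g′)
    member⇒power : ∀ {g} → Member g → ∃ λ n → g ≈ y ^ n

-- In `CoreQuotient` the elements `N b c` are powers of y^m, because x^p is trivial; their closure
-- under conjugation is the `slides` of that quotient.
coreSubgroup : ∀ {M x y p q} .{{_ : NonZero p}} .{{_ : NonZero q}} (T : TightPair M x y p q)
  (C : TightPairProperties.Core T) →
  Σ (NormalSubgroupOf⟨_⟩ {M} y) λ S → NormalSubgroupOf⟨_⟩.Member S (Powers._^_ M y (TightPairProperties.Core.m C))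
coreSubgroup {M} {x} {y} {p} {q} T C = record
    { Member = λ g → ∃₂ λ b c → g ≈ N b c
    ; resp = λ { g≈h (b , c , g≈) → b , c , trans (sym g≈h) g≈ }
    ; ε-closed = 0 , 0 , sym (identityˡ ε)
    ; ∙-closed = λ { (b , c , g≈) (b′ , c′ , h≈) → b + b′ , c + c′ , trans (∙-cong g≈ h≈) (N-∙ b c b′ c′) }
    ; inverse-closed = λ { g′g gg′ (b , c , g≈) → b * pred p , c * pred q ,
        cancelˡ g′g (trans gg′ (sym (trans (∙-congʳ g≈) (N-inverse b c)))) }
    ; conjugate-closed = λ { {g} {g′} gg′ (b , c , n≈) →
        let b′ , c′ , eq = slides g′ b c in b′ , c′ , trans (∙-congʳ (∙-congˡ n≈)) (conjugate gg′ eq) }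
    ; member⇒power = λ { (b , c , g≈) → m * c , trans g≈ (N≈y b c) }
    }
  , 0 , 1 , sym (trans (N≈y 0 1) (^-congʳ y (*-identityʳ m)))
  where
  open Monoid M
  open Powers M
  open TightPair T using (xᵖ≈ε)
  open TightPairProperties.Core C using (m)
  open CoreQuotient T C using (N; N≈; N-∙; N-inverse; slides)
  N≈y : ∀ b c → N b c ≈ y ^ (m * c)
  N≈y b c = trans (N≈ b c) (trans (∙-congʳ (^-∣ {x} {p} {p * b} xᵖ≈ε (m∣m*n b))) (identityˡ _))

-- Finite sets and counting.

open ≡ using (refl; sym; trans; cong; subst)

↔-injective : ∀ {A B : Set} (f : A ↔ B) {a b} → Inverse.to f a ≡ Inverse.to f b → a ≡ b
↔-injective f {a} {b} eq =
  trans (sym (Inverse.strictlyInverseʳ f a)) (trans (cong (Inverse.from f) eq) (Inverse.strictlyInverseʳ f b))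

Irrelevant : {A : Set} → (A → Set) → Set
Irrelevant R = ∀ {a} (r s : R a) → r ≡ s

≡true-irrelevant : {b : Bool} (r s : b ≡ true) → r ≡ s
≡true-irrelevant refl refl = refl

≡true²-irrelevant : {b c : Bool} (r s : b ≡ true × c ≡ true) → r ≡ s
≡true²-irrelevant (refl , refl) (refl , refl) = refl

Σ-≡ : {A : Set} {R : A → Set} → Irrelevant R → ∀ {a b} {r : R a} {s : R b} → a ≡ b → (a , r) ≡ (b , s)
Σ-≡ irr refl = cong (_ ,_) (irr _ _)

module FiniteSubset {A : Set} {R : A → Set} {n} (irr : Irrelevant R) (size : Σ A R ↔ Fin n) where
  index : ∀ {a} → R a → Fin n
  index r = Inverse.to size (_ , r)

  index-injective : ∀ {a b} {r : R a} {s : R b} → index r ≡ index s → a ≡ b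
  index-injective eq = cong proj₁ (↔-injective size eq)

  index-cong : ∀ {a b} {r : R a} {s : R b} → a ≡ b → index r ≡ index s
  index-cong eq = cong (Inverse.to size) (Σ-≡ irr eq)

  -- Vertices, edges and faces come without decidable equality; they are compared through their
  -- indices in a finite set containing both.
  ≟-in : ∀ {a b} → R a → R b → Dec (a ≡ b)
  ≟-in r s = map′ index-injective index-cong (index r Fin.≟ index s)

module TwoSubset {A : Set} {R : A → Set} (irr : Irrelevant R) (size : Σ A R ↔ Fin 2) where
  open FiniteSubset irr size public

  other : ∀ {a} → R a → ∃ λ b → R b × a ≢ b
  other r with index r in eq
  ... | Fin.zero = _ , proj₂ (Inverse.from size (Fin.suc Fin.zero)) , λ a≡b →
    Fin.0≢1+n (trans (sym eq) (trans (index-cong a≡b) (Inverse.strictlyInverseˡ size _)))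
  ... | Fin.suc Fin.zero = _ , proj₂ (Inverse.from size Fin.zero) , λ a≡b →
    Fin.0≢1+n (sym (trans (sym eq) (trans (index-cong a≡b) (Inverse.strictlyInverseˡ size _))))

  two : ∀ {a b c} → R a → R b → a ≢ b → R c → c ≡ a ⊎ c ≡ b
  two r s a≢b t with index r in r≡ | index s in s≡ | index t in t≡
  ... | Fin.zero         | Fin.zero         | _                = ⊥-elim (a≢b (index-injective (trans r≡ (sym s≡))))
  ... | Fin.suc Fin.zero | Fin.suc Fin.zero | _                = ⊥-elim (a≢b (index-injective (trans r≡ (sym s≡))))
  ... | Fin.zero         | Fin.suc Fin.zero | Fin.zero         = inj₁ (index-injective (trans t≡ (sym r≡)))
  ... | Fin.zero         | Fin.suc Fin.zero | Fin.suc Fin.zero = inj₂ (index-injective (trans t≡ (sym s≡)))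
  ... | Fin.suc Fin.zero | Fin.zero         | Fin.zero         = inj₂ (index-injective (trans t≡ (sym s≡)))
  ... | Fin.suc Fin.zero | Fin.zero         | Fin.suc Fin.zero = inj₁ (index-injective (trans t≡ (sym r≡)))

  -- Since `f` fixes `a`, injectivity forbids it to send another element there.
  fixes-other : (f : A → A) → (∀ {a b} → f a ≡ f b → a ≡ b) →
    ∀ {a b} → R a → f a ≡ a → R b → R (f b) → f b ≡ b
  fixes-other f inj {a} {b} r fa≡a s t with ≟-in r s
  ... | yes refl = fa≡a
  ... | no a≢b with two r s a≢b t
  ...   | inj₁ fb≡a = ⊥-elim (a≢b (inj (trans fa≡a (sym fb≡a))))
  ...   | inj₂ fb≡b = fb≡b

fold-Star : {A : Set} {R : A → A → Set} (Q : A → Set) → (∀ {a b} → R a b → Q a → Q b) →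
            ∀ {a b} → Star R a b → Q a → Q b
fold-Star Q step Star.ε Qa = Qa
fold-Star Q step (r ◅ rs) Qa = fold-Star Q step rs (step r Qa)

-- If `k` were missed, deleting it would leave an injection into a smaller set.
injective⇒surjective : ∀ {n} (f : Fin n → Fin n) → (∀ {i j} → f i ≡ f j → i ≡ j) → ∀ k → ∃ λ i → f i ≡ k
injective⇒surjective {suc n} f inj k with any? (λ i → f i Fin.≟ k)
... | yes found = found
... | no missed = ⊥-elim (1+n≰n (injective⇒≤ {f = λ i → punchOut (k≢ i)}
    (λ eq → inj (punchOut-injective (k≢ _) (k≢ _) eq))))
  where
  k≢ : ∀ i → k ≢ f i
  k≢ i k≡ = missed (i , sym k≡)

-- a describes the orbit of an element under a cyclic group whose generator has n-th power 1 iff T n.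
orbit-order : ∀ {p} .{{_ : NonZero p}} (T : ℕ → Set) (a : ℕ → Fin p) →
  (∀ n i → T n → a (n + i) ≡ a i) → (∀ i d → a (i + d) ≡ a i → T d) →
  (∀ n → T (suc n) → ∀ k → ∃ λ i → a i ≡ k) →
  T p × (∀ i → T i → p ∣ i)
orbit-order {p} T a period return onto = Tp , λ i Ti → m%n≡0⇒n∣m i p (no-residue i Ti)
  where
  periods : ∀ c n i → T n → a (c * n + i) ≡ a i
  periods zero n i Tn = refl
  periods (suc c) n i Tn = trans (cong a (+-assoc n (c * n) i)) (trans (period n (c * n + i) Tn) (periods c n i Tn))
  reduce : ∀ n .{{_ : NonZero n}} i → T n → a i ≡ a (i % n)
  reduce n i Tn = trans (cong a (trans (m≡m%n+[m/n]*n i n) (+-comm (i % n) _))) (periods (i / n) n (i % n) Tn)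
  -- With period `suc n`, at most `suc n` values occur, and they exhaust `Fin p`.
  lower-bound : ∀ n → T (suc n) → p ≤ suc n
  lower-bound n Tn = injective⇒≤ {f = λ k → fromℕ< (m%n<n (proj₁ (onto n Tn k)) (suc n))} λ {k} {l} eq →
    trans (sym (proj₂ (onto n Tn k))) (trans (reduce (suc n) _ Tn)
      (trans (cong a (fromℕ<-injective _ _ (m%n<n (proj₁ (onto n Tn k)) (suc n)) (m%n<n (proj₁ (onto n Tn l)) (suc n)) eq))
        (trans (sym (reduce (suc n) _ Tn)) (proj₂ (onto n Tn l)))))
  -- Two of p + 1 terms coincide, which gives a period between 1 and `p`; the lower bound makes it
  -- equal to `p`.
  collision = pigeonhole (n<1+n p) (λ (i : Fin (suc p)) → a (toℕ i))
  Tp : T p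
  Tp with collision
  ... | i , j , i<j , eq with toℕ j ∸ toℕ i | m+[n∸m]≡n (<⇒≤ i<j) | m<n⇒0<n∸m i<j
  ...   | suc d | i+d≡j | _ = subst T (≤-antisym d≤p (lower-bound d Td)) Td
    where
    Td : T (suc d)
    Td = return (toℕ i) (suc d) (trans (cong a i+d≡j) (sym eq))
    d≤p : suc d ≤ p
    d≤p = ≤-trans (m≤n+m (suc d) (toℕ i)) (subst (_≤ p) (sym i+d≡j) (s≤s⁻¹ (toℕ<n j)))
  no-residue : ∀ i → T i → i % p ≡ 0
  no-residue i Ti with i % p | reduce p i Tp | m%n<n i p
  ... | zero  | _  | _   = refl
  ... | suc r | ai≡ | r<p = ⊥-elim (<⇒≱ r<p (lower-bound r (return 0 (suc r)
    (trans (sym ai≡) (trans (cong a (sym (+-identityʳ i))) (period i 0 Ti))))))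

triples-injective⇒surjective : ∀ {A : Set} {a b c} → A ↔ Fin (a * b * c) → (g : Fin a × Fin b × Fin c → A) →
  (∀ t t′ → g t ≡ g t′ → t ≡ t′) → ∀ z → ∃ λ t → g t ≡ z
triples-injective⇒surjective {A} {a} {b} {c} size g g-injective z =
  let k , eq = injective⇒surjective (λ k → Inverse.to size (g (decode k)))
                 (λ {k} {l} eq → trans (sym (encode-decode k)) (trans
                   (cong encode (g-injective (decode k) (decode l) (↔-injective size eq))) (encode-decode l)))
                 (Inverse.to size z)
  in decode k , ↔-injective size eq
  where
  decode : Fin (a * b * c) → Fin a × Fin b × Fin c
  decode k = let ij , l = remQuot {a * b} c k
                 i , j = remQuot {a} b ij
             in i , j , l
  encode : Fin a × Fin b × Fin c → Fin (a * b * c)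
  encode (i , j , l) = combine (combine i j) l
  encode-decode : ∀ k → encode (decode k) ≡ k
  encode-decode k = trans (cong (λ ij → combine ij (proj₂ (remQuot {a * b} c k))) (combine-remQuot {a} b _))
                          (combine-remQuot {a * b} c k)

-- Free action of the automorphisms on flags.

module Automorphisms (P : Polyhedron) where
  open Polyhedron P

  infixr 5 _·v_ _·e_ _·f_
  _·v_ : Aut → V → V
  α ·v v = Inverse.to (aV α) v
  _·e_ : Aut → E → E
  α ·e e = Inverse.to (aE α) e
  _·f_ : Aut → F → F
  α ·f f = Inverse.to (aF α) f

  infix 4 _<ᵉ_ _<ᶠ_
  _<ᵉ_ : V → E → Set
  v <ᵉ e = ve v e ≡ true
  _<ᶠ_ : E → F → Set
  e <ᶠ f = ef e f ≡ true

  ·-<ᵉ : ∀ α {v e} → v <ᵉ e → α ·v v <ᵉ α ·e e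
  ·-<ᵉ α {v} {e} = trans (pres-ve α v e)
  ·-<ᶠ : ∀ α {e f} → e <ᶠ f → α ·e e <ᶠ α ·f f
  ·-<ᶠ α {e} {f} = trans (pres-ef α e f)

  ·v-injective : ∀ α {v w} → α ·v v ≡ α ·v w → v ≡ w
  ·v-injective α = ↔-injective (aV α)
  ·e-injective : ∀ α {d e} → α ·e d ≡ α ·e e → d ≡ e
  ·e-injective α = ↔-injective (aE α)
  ·f-injective : ∀ α {f g} → α ·f f ≡ α ·f g → f ≡ g
  ·f-injective α = ↔-injective (aF α)

  module VerticesOf (e : E) = TwoSubset {R = _<ᵉ e} ≡true-irrelevant (edge-two-vertices e)
  module FacesOf (e : E) = TwoSubset {R = e <ᶠ_} ≡true-irrelevant (edge-two-faces e)
  module EdgesBetween {v : V} {f : F} {e : E} (v<e : v <ᵉ e) (e<f : e <ᶠ f) =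
    TwoSubset {R = λ e → v <ᵉ e × e <ᶠ f} ≡true²-irrelevant (diamond v f (e , v<e , e<f))

  ≈F⇒≡ : ∀ {Φ Ψ} → Φ ≈F Ψ → Φ ≡ Ψ
  ≈F⇒≡ {t , i} {_ , j} (refl , refl , refl) = cong (t ,_) (≡true²-irrelevant i j)

  -- A record, unlike _≈A_, lets the two automorphisms be inferred.
  infix 4 _≋_
  record _≋_ (α β : Aut) : Set where
    field
      onV : ∀ v → α ·v v ≡ β ·v v
      onE : ∀ e → α ·e e ≡ β ·e e
      onF : ∀ f → α ·f f ≡ β ·f f
  open _≋_ public

  ≋⇒≈A : ∀ {α β} → α ≋ β → α ≈A β
  ≋⇒≈A eq = onV eq , onE eq , onF eq

  ≈A⇒≋ : ∀ {α β} → α ≈A β → α ≋ β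
  ≈A⇒≋ (hv , he , hf) = record { onV = hv ; onE = he ; onF = hf }

  Fixes : Aut → V → E → F → Set
  Fixes α v e f = α ·v v ≡ v × α ·e e ≡ e × α ·f f ≡ f

  module Stabiliser (α : Aut) where
    fixes-vertices : ∀ {v e} → v <ᵉ e → α ·v v ≡ v → α ·e e ≡ e → ∀ {w} → w <ᵉ e → α ·v w ≡ w
    fixes-vertices {v} {e} v<e αv αe {w} w<e =
      VerticesOf.fixes-other e (α ·v_) (·v-injective α) v<e αv w<e (subst (α ·v w <ᵉ_) αe (·-<ᵉ α w<e))

    fixes-faces : ∀ {e f} → e <ᶠ f → α ·f f ≡ f → α ·e e ≡ e → ∀ {g} → e <ᶠ g → α ·f g ≡ g
    fixes-faces {e} {f} e<f αf αe {g} e<g =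
      FacesOf.fixes-other e (α ·f_) (·f-injective α) e<f αf e<g (subst (_<ᶠ α ·f g) αe (·-<ᶠ α e<g))

    fixes-edges : ∀ {v e f} → v <ᵉ e → e <ᶠ f → Fixes α v e f → ∀ {d} → v <ᵉ d → d <ᶠ f → α ·e d ≡ d
    fixes-edges v<e e<f (αv , αe , αf) {d} v<d d<f =
      EdgesBetween.fixes-other v<e e<f (α ·e_) (·e-injective α) (v<e , e<f) αe (v<d , d<f)
        (subst (_<ᵉ α ·e d) αv (·-<ᵉ α v<d) , subst (α ·e d <ᶠ_) αf (·-<ᶠ α d<f))

    -- Fixedness is carried along a walk of edges and faces around `v`. The invariant `Q` includes
    -- the neighbours, since fixedness of one element alone does not propagate.
    fixes-at-vertex : ∀ {v e f} → v <ᵉ e → e <ᶠ f → Fixes α v e f →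
      ∀ {d g} → v <ᵉ d → d <ᶠ g → α ·e d ≡ d × α ·f g ≡ g
    fixes-at-vertex {v} {e} {f} v<e e<f (αv , αe , αf) {d} {g} v<d d<g =
      let αd , αd-faces = fold-Star Q step (vertex-strongly-connected v (inj₂ (inj₁ e)) (inj₂ (inj₁ d)) v<e v<d)
                            (αe , fixes-faces e<f αf αe)
      in αd , αd-faces d<g
      where
      Q : El → Set
      Q (inj₁ _) = ⊤
      Q (inj₂ (inj₁ e)) = α ·e e ≡ e × (∀ {f} → e <ᶠ f → α ·f f ≡ f)
      Q (inj₂ (inj₂ f)) = α ·f f ≡ f × (∀ {e} → v <ᵉ e → e <ᶠ f → α ·e e ≡ e)
      step : ∀ {a b} → Inc (inj₁ v) a × Inc (inj₁ v) b × Inc a b → Q a → Q b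
      step {inj₂ (inj₁ e)} {inj₂ (inj₂ f)} (v<e , _ , e<f) (αe , αfs) =
        αfs e<f , fixes-edges v<e e<f (αv , αe , αfs e<f)
      step {inj₂ (inj₂ f)} {inj₂ (inj₁ e)} (_ , v<e , e<f) (αf , αes) =
        αes v<e e<f , fixes-faces e<f αf (αes v<e e<f)

    fixes-at-face : ∀ {v e f} → v <ᵉ e → e <ᶠ f → Fixes α v e f →
      ∀ {w d} → w <ᵉ d → d <ᶠ f → α ·v w ≡ w × α ·e d ≡ d
    fixes-at-face {v} {e} {f} v<e e<f (αv , αe , αf) {w} {d} w<d d<f =
      let αd , αd-vertices = fold-Star Q step (face-strongly-connected f (inj₂ (inj₁ e)) (inj₂ (inj₁ d)) e<f d<f)
                               (αe , fixes-vertices v<e αv αe)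
      in αd-vertices w<d , αd
      where
      Q : El → Set
      Q (inj₁ v) = α ·v v ≡ v × (∀ {e} → v <ᵉ e → e <ᶠ f → α ·e e ≡ e)
      Q (inj₂ (inj₁ e)) = α ·e e ≡ e × (∀ {v} → v <ᵉ e → α ·v v ≡ v)
      Q (inj₂ (inj₂ _)) = ⊤
      step : ∀ {a b} → Inc (inj₂ (inj₂ f)) a × Inc (inj₂ (inj₂ f)) b × Inc a b → Q a → Q b
      step {inj₂ (inj₁ e)} {inj₁ v} (e<f , _ , v<e) (αe , αvs) =
        αvs v<e , fixes-edges v<e e<f (αvs v<e , αe , αf)
      step {inj₁ v} {inj₂ (inj₁ e)} (_ , e<f , v<e) (αv , αes) =
        αes v<e e<f , fixes-vertices v<e αv (αes v<e e<f)
      step {inj₂ (inj₁ _)} {inj₂ (inj₁ _)} (_ , _ , ())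
      step {inj₂ (inj₁ _)} {inj₂ (inj₂ _)} (_ , () , _)

    -- The invariant for walks in the whole incidence graph: every flag through the element is
    -- fixed.
    FixedStar : El → Set
    FixedStar (inj₁ v) = α ·v v ≡ v × (∀ {e f} → v <ᵉ e → e <ᶠ f → α ·e e ≡ e × α ·f f ≡ f)
    FixedStar (inj₂ (inj₁ e)) = α ·e e ≡ e × (∀ {v} → v <ᵉ e → α ·v v ≡ v) × (∀ {f} → e <ᶠ f → α ·f f ≡ f)
    FixedStar (inj₂ (inj₂ f)) = α ·f f ≡ f × (∀ {v e} → v <ᵉ e → e <ᶠ f → α ·v v ≡ v × α ·e e ≡ e)

    fixed-vertex : ∀ {v e f} → v <ᵉ e → e <ᶠ f → Fixes α v e f → FixedStar (inj₁ v)
    fixed-vertex v<e e<f fix = proj₁ fix , fixes-at-vertex v<e e<f fix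

    fixed-edge : ∀ {v e f} → v <ᵉ e → e <ᶠ f → Fixes α v e f → FixedStar (inj₂ (inj₁ e))
    fixed-edge v<e e<f (αv , αe , αf) = αe , fixes-vertices v<e αv αe , fixes-faces e<f αf αe

    fixed-face : ∀ {v e f} → v <ᵉ e → e <ᶠ f → Fixes α v e f → FixedStar (inj₂ (inj₂ f))
    fixed-face v<e e<f fix = proj₂ (proj₂ fix) , fixes-at-face v<e e<f fix

    spread : ∀ {a b} → ⊤ × ⊤ × Inc a b → FixedStar a → FixedStar b
    spread {inj₁ v} {inj₂ (inj₁ e)} (_ , _ , v<e) (αv , rest) =
      let f , e<f = Inverse.from (edge-two-faces e) Fin.zero
      in fixed-edge v<e e<f (αv , rest v<e e<f)
    spread {inj₁ v} {inj₂ (inj₂ f)} (_ , _ , e , v<e , e<f) (αv , rest) =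
      fixed-face v<e e<f (αv , rest v<e e<f)
    spread {inj₂ (inj₁ e)} {inj₁ v} (_ , _ , v<e) (αe , αvs , αfs) =
      let f , e<f = Inverse.from (edge-two-faces e) Fin.zero
      in fixed-vertex v<e e<f (αvs v<e , αe , αfs e<f)
    spread {inj₂ (inj₁ e)} {inj₂ (inj₂ f)} (_ , _ , e<f) (αe , αvs , αfs) =
      let v , v<e = Inverse.from (edge-two-vertices e) Fin.zero
      in fixed-face v<e e<f (αvs v<e , αe , αfs e<f)
    spread {inj₂ (inj₂ f)} {inj₁ v} (_ , _ , e , v<e , e<f) (αf , rest) =
      let αv , αe = rest v<e e<f
      in fixed-vertex v<e e<f (αv , αe , αf)
    spread {inj₂ (inj₂ f)} {inj₂ (inj₁ e)} (_ , _ , e<f) (αf , rest) =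
      let v , v<e = Inverse.from (edge-two-vertices e) Fin.zero
          αv , αe = rest v<e e<f
      in fixed-edge v<e e<f (αv , αe , αf)

    fixes-flag⇒≈id : ∀ {v e f} → v <ᵉ e → e <ᶠ f → Fixes α v e f → α ≋ idA
    fixes-flag⇒≈id {v} {e} {f} v<e e<f fix =
      record { onV = λ w → proj₁ (fixed (inj₁ w)) ; onE = λ d → proj₁ (fixed (inj₂ (inj₁ d)))
             ; onF = λ g → proj₁ (fixed (inj₂ (inj₂ g))) }
      where
      fixed : ∀ a → FixedStar a
      fixed a = fold-Star FixedStar spread (connected (inj₁ v) a tt tt) (fixed-vertex v<e e<f fix)

  open Stabiliser public using (fixes-flag⇒≈id)

  act-free : ∀ α β Φ → act α Φ ≡ act β Φ → α ≋ β
  act-free α β ((v , e , f) , v<e , e<f) eq = record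
    { onV = λ w → trans (sym (Inverse.strictlyInverseˡ (aV β) _)) (cong (β ·v_) (onV β⁻¹α w))
    ; onE = λ d → trans (sym (Inverse.strictlyInverseˡ (aE β) _)) (cong (β ·e_) (onE β⁻¹α d))
    ; onF = λ g → trans (sym (Inverse.strictlyInverseˡ (aF β) _)) (cong (β ·f_) (onF β⁻¹α g)) }
    where
    β⁻¹α : invA β ∘A α ≋ idA
    β⁻¹α = fixes-flag⇒≈id (invA β ∘A α) v<e e<f
      ( trans (cong (Inverse.from (aV β)) (cong fv eq)) (Inverse.strictlyInverseʳ (aV β) v)
      , trans (cong (Inverse.from (aE β)) (cong fe eq)) (Inverse.strictlyInverseʳ (aE β) e)
      , trans (cong (Inverse.from (aF β)) (cong ff eq)) (Inverse.strictlyInverseʳ (aF β) f))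

  autMonoid : Monoid 0ℓ 0ℓ
  autMonoid = record
    { Carrier = Aut ; _≈_ = _≋_ ; _∙_ = _∘A_ ; ε = idA
    ; isMonoid = record
      { isSemigroup = record
        { isMagma = record
          { isEquivalence = record
            { refl = ≋-refl
            ; sym = λ h → record { onV = sym ∘ onV h ; onE = sym ∘ onE h ; onF = sym ∘ onF h }
            ; trans = λ h k → record
              { onV = λ v → trans (onV h v) (onV k v)
              ; onE = λ e → trans (onE h e) (onE k e)
              ; onF = λ f → trans (onF h f) (onF k f) } }
          ; ∙-cong = λ { {_} {α} h k → record
              { onV = λ v → trans (onV h _) (cong (α ·v_) (onV k v))
              ; onE = λ e → trans (onE h _) (cong (α ·e_) (onE k e))
              ; onF = λ f → trans (onF h _) (cong (α ·f_) (onF k f)) } } }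
        ; assoc = λ _ _ _ → record { onV = λ _ → refl ; onE = λ _ → refl ; onF = λ _ → refl } }
      ; identity = (λ _ → record { onV = λ _ → refl ; onE = λ _ → refl ; onF = λ _ → refl })
                 , (λ _ → record { onV = λ _ → refl ; onE = λ _ → refl ; onF = λ _ → refl }) } }
    where
    ≋-refl : ∀ {α} → α ≋ α
    ≋-refl = record { onV = λ _ → refl ; onE = λ _ → refl ; onF = λ _ → refl }

  invA-inverseʳ : ∀ α → α ∘A invA α ≋ idA
  invA-inverseʳ α = record
    { onV = Inverse.strictlyInverseˡ (aV α) ; onE = Inverse.strictlyInverseˡ (aE α) ; onF = Inverse.strictlyInverseˡ (aF α) }

  invA-inverseˡ : ∀ α → invA α ∘A α ≋ idA
  invA-inverseˡ α = record
    { onV = Inverse.strictlyInverseʳ (aV α) ; onE = Inverse.strictlyInverseʳ (aE α) ; onF = Inverse.strictlyInverseʳ (aF α) }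

-- Chirality and the orders of the rotations.

≢-≢⇒≡ : {a b c : Bool} → a ≢ b → c ≢ b → a ≡ c
≢-≢⇒≡ {a} {b} {c} a≢b c≢b = trans (Bool.¬-not a≢b) (sym (Bool.¬-not c≢b))

module ChiralAction (P : Polyhedron) (chiral : Chiral P) where
  open Polyhedron P
  open Automorphisms P

  class : Flag → Bool
  class = proj₁ chiral

  adjacent⇒class≢ : ∀ i Φ Ψ → Adj i Φ Ψ → class Φ ≢ class Ψ
  adjacent⇒class≢ = proj₁ (proj₂ chiral)

  class-transitive : ∀ Φ Ψ → class Φ ≡ class Ψ → ∃ λ α → act α Φ ≡ Ψ
  class-transitive Φ Ψ eq = let α , αΦ≈Ψ = proj₁ (proj₂ (proj₂ chiral)) Φ Ψ eq in α , ≈F⇒≡ αΦ≈Ψ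

  act-∘ : ∀ α β Φ → act (α ∘A β) Φ ≡ act α (act β Φ)
  act-∘ α β Φ = ≈F⇒≡ (refl , refl , refl)

  act-inv : ∀ α Φ → act (invA α) (act α Φ) ≡ Φ
  act-inv α ((v , e , f) , _) = ≈F⇒≡
    ( Inverse.strictlyInverseʳ (aV α) v , Inverse.strictlyInverseʳ (aE α) e , Inverse.strictlyInverseʳ (aF α) f)

  -- An automorphism exchanging the two classes would make the group transitive on all flags.
  class-invariant : ∀ α Ψ → class (act α Ψ) ≡ class Ψ
  class-invariant α Ψ with class (act α Ψ) Bool.≟ class Ψ
  ... | yes eq = eq
  ... | no neq = ⊥-elim (proj₂ (proj₂ (proj₂ chiral)) λ Φ₁ Φ₂ →
      let β , eq = transitive Φ₁ Φ₂ in β , cong fv eq , cong fe eq , cong ff eq)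
    where
    through : ∀ {Φ Φ₁ Φ₂ Φ₃} β γ δ → act β Φ ≡ Φ₁ → act γ Φ₁ ≡ Φ₂ → act δ Φ₂ ≡ Φ₃ → act (δ ∘A (γ ∘A β)) Φ ≡ Φ₃
    through {Φ} β γ δ refl refl refl = trans (act-∘ δ (γ ∘A β) Φ) (cong (act δ) (act-∘ γ β Φ))
    -- Flags of different classes are joined through `Ψ` and `act α Ψ`, beginning with the one in
    -- the class of `Φ₁`.
    transitive : ∀ Φ₁ Φ₂ → ∃ λ β → act β Φ₁ ≡ Φ₂
    transitive Φ₁ Φ₂ with class Φ₁ Bool.≟ class Φ₂ | class Φ₁ Bool.≟ class Ψ
    ... | yes eq | _ = class-transitive Φ₁ Φ₂ eq
    ... | no neq₂ | yes eq =
      let β , β≡ = class-transitive Φ₁ Ψ eq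
          δ , δ≡ = class-transitive (act α Ψ) Φ₂ (≢-≢⇒≡ neq λ eq₂ → neq₂ (trans eq (sym eq₂)))
      in δ ∘A (α ∘A β) , through β α δ β≡ refl δ≡
    ... | no neq₂ | no neq₁ =
      let β , β≡ = class-transitive Φ₁ (act α Ψ) (≢-≢⇒≡ neq₁ neq)
          δ , δ≡ = class-transitive Ψ Φ₂ (≢-≢⇒≡ (neq₁ ∘ sym) (neq₂ ∘ sym))
      in δ ∘A (invA α ∘A β) , through β (invA α) δ β≡ (act-inv α Ψ) δ≡

  no-adjacency : ∀ i α Ψ → ¬ Adj i Ψ (act α Ψ)
  no-adjacency i α Ψ adj = adjacent⇒class≢ i Ψ (act α Ψ) adj (sym (class-invariant α Ψ))

  -- If only `v` moved, the flag would go to an adjacent one, in the other class, but automorphisms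
  -- preserve classes. The same argument serves for edges and faces below.
  fixes-vertex : ∀ α {v e f} → v <ᵉ e → e <ᶠ f → α ·e e ≡ e → α ·f f ≡ f → α ·v v ≡ v
  fixes-vertex α {v} {e} v<e e<f αe αf with VerticesOf.≟-in e v<e (subst (α ·v v <ᵉ_) αe (·-<ᵉ α v<e))
  ... | yes eq = sym eq
  ... | no neq = ⊥-elim (no-adjacency Fin.zero α (_ , v<e , e<f) (neq , sym αe , sym αf))

  fixes-edge : ∀ α {v e f} → v <ᵉ e → e <ᶠ f → α ·v v ≡ v → α ·f f ≡ f → α ·e e ≡ e
  fixes-edge α {v} {e} v<e e<f αv αf with EdgesBetween.≟-in v<e e<f (v<e , e<f)
      (subst (_<ᵉ α ·e e) αv (·-<ᵉ α v<e) , subst (α ·e e <ᶠ_) αf (·-<ᶠ α e<f))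
  ... | yes eq = sym eq
  ... | no neq = ⊥-elim (no-adjacency (Fin.suc Fin.zero) α (_ , v<e , e<f) (sym αv , neq , sym αf))

  fixes-face : ∀ α {v e f} → v <ᵉ e → e <ᶠ f → α ·v v ≡ v → α ·e e ≡ e → α ·f f ≡ f
  fixes-face α {v} {e} {f} v<e e<f αv αe with FacesOf.≟-in e e<f (subst (_<ᶠ α ·f f) αe (·-<ᶠ α e<f))
  ... | yes eq = sym eq
  ... | no neq = ⊥-elim (no-adjacency (Fin.suc (Fin.suc Fin.zero)) α (_ , v<e , e<f) (sym αv , sym αe , neq))

  open Monoid autMonoid using (_≈_)
  open Powers autMonoid

  ^-fixes-vertex : ∀ α {v} → α ·v v ≡ v → ∀ i → (α ^ i) ·v v ≡ v
  ^-fixes-vertex α αv zero = refl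
  ^-fixes-vertex α αv (suc i) = trans (cong (α ·v_) (^-fixes-vertex α αv i)) αv

  ^-fixes-face : ∀ α {f} → α ·f f ≡ f → ∀ i → (α ^ i) ·f f ≡ f
  ^-fixes-face α αf zero = refl
  ^-fixes-face α αf (suc i) = trans (cong (α ·f_) (^-fixes-face α αf i)) αf

  ^-shift-edge : ∀ α i e → (α ^ i) ·e (α ·e e) ≡ (α ^ suc i) ·e e
  ^-shift-edge α zero e = refl
  ^-shift-edge α (suc i) e = cong (α ·e_) (^-shift-edge α i e)

  ^-shift-face : ∀ α i f → (α ^ i) ·f (α ·f f) ≡ (α ^ suc i) ·f f
  ^-shift-face α zero f = refl
  ^-shift-face α (suc i) f = cong (α ·f_) (^-shift-face α i f)

  ^-+-edge : ∀ α i j e → (α ^ (i + j)) ·e e ≡ (α ^ i) ·e ((α ^ j) ·e e)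
  ^-+-edge α i j = onE (^-+ α i j)

  ^-+-face : ∀ α i j f → (α ^ (i + j)) ·f f ≡ (α ^ i) ·f ((α ^ j) ·f f)
  ^-+-face α i j = onF (^-+ α i j)

  -- A turn of `f` by one step: `e` and its image share the vertex `v`.
  record FaceRotation (v : V) (e : E) (f : F) (x : Aut) : Set where
    field
      xf≡f : x ·f f ≡ f
      v<xe : v <ᵉ x ·e e
      xe≢e : x ·e e ≢ e
      xv≢v : x ·v v ≢ v

  -- A turn about `v` by one step: `f` and its image share the edge `e`.
  record VertexRotation (v : V) (e : E) (f : F) (y : Aut) : Set where
    field
      yv≡v : y ·v v ≡ v
      e<yf : e <ᶠ y ·f f
      ye≢e : y ·e e ≢ e
      yf≢f : y ·f f ≢ f

  module _ {v e f} (v<e : v <ᵉ e) (e<f : e <ᶠ f) where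

    -- The orbit of `e` is traced among the `p` edges of `f`. If x^d fixes `e`, it fixes the base
    -- flag by chirality and is trivial; the orbit is everything because the boundary of `f` is
    -- connected.
    faceRotation-order : ∀ {x p} .{{_ : NonZero p}} → FaceRotation v e f x → Σ E (_<ᶠ f) ↔ Fin p →
      x ^ p ≈ idA × (∀ i → x ^ i ≈ idA → p ∣ i)
    faceRotation-order {x} {p} rot size = orbit-order (λ n → x ^ n ≈ idA) (λ i → index (xⁱe<f i)) period return onto
      where
      open FaceRotation rot
      open FiniteSubset {R = _<ᶠ f} ≡true-irrelevant size
      xⁱf : ∀ i → (x ^ i) ·f f ≡ f
      xⁱf = ^-fixes-face x xf≡f
      xⁱe<f : ∀ i → (x ^ i) ·e e <ᶠ f
      xⁱe<f i = subst ((x ^ i) ·e e <ᶠ_) (xⁱf i) (·-<ᶠ (x ^ i) e<f)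
      period : ∀ n i → x ^ n ≈ idA → index (xⁱe<f (n + i)) ≡ index (xⁱe<f i)
      period n i xⁿ≈id = index-cong (trans (^-+-edge x n i e) (onE xⁿ≈id _))
      return : ∀ i d → index (xⁱe<f (i + d)) ≡ index (xⁱe<f i) → x ^ d ≈ idA
      return i d eq = fixes-flag⇒≈id (x ^ d) v<e e<f (fixes-vertex (x ^ d) v<e e<f xᵈe (xⁱf d) , xᵈe , xⁱf d)
        where
        xᵈe : (x ^ d) ·e e ≡ e
        xᵈe = ·e-injective (x ^ i) (trans (sym (^-+-edge x i d e)) (index-injective eq))
      onto : ∀ n → x ^ suc n ≈ idA → ∀ k → ∃ λ i → index (xⁱe<f i) ≡ k
      onto n xⁿ≈id k =
        let d , d<f = Inverse.from size k
            i , d≡ = fold-Star Q step (face-strongly-connected f (inj₂ (inj₁ e)) (inj₂ (inj₁ d)) e<f d<f) (0 , refl)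
        in i , trans (index-cong (sym d≡)) (Inverse.strictlyInverseˡ size k)
        where
        Q : El → Set
        Q (inj₁ w) = ∃ λ i → w ≡ (x ^ i) ·v v
        Q (inj₂ (inj₁ d)) = ∃ λ i → d ≡ (x ^ i) ·e e
        Q (inj₂ (inj₂ _)) = ⊤
        v<xⁱ⁺¹e : ∀ i → (x ^ i) ·v v <ᵉ (x ^ suc i) ·e e
        v<xⁱ⁺¹e i = subst ((x ^ i) ·v v <ᵉ_) (^-shift-edge x i e) (·-<ᵉ (x ^ i) v<xe)
        xⁱe≢ : ∀ i → (x ^ i) ·e e ≢ (x ^ suc i) ·e e
        xⁱe≢ i eq = xe≢e (sym (·e-injective (x ^ i) (trans eq (sym (^-shift-edge x i e)))))
        xⁱv≢ : ∀ i → (x ^ i) ·v v ≢ (x ^ suc i) ·v v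
        xⁱv≢ zero eq = xv≢v (sym eq)
        xⁱv≢ (suc i) eq = xⁱv≢ i (·v-injective x eq)
        step : ∀ {a b} → Inc (inj₂ (inj₂ f)) a × Inc (inj₂ (inj₂ f)) b × Inc a b → Q a → Q b
        step {inj₁ w} {inj₂ (inj₁ d)} (_ , d<f , w<d) (i , refl)
          with EdgesBetween.two w<d d<f (·-<ᵉ (x ^ i) v<e , xⁱe<f i) (v<xⁱ⁺¹e i , xⁱe<f (suc i)) (xⁱe≢ i) (w<d , d<f)
        ... | inj₁ eq = i , eq
        ... | inj₂ eq = suc i , eq
        -- The vertices of x^i e are x^(i-1) v and x^i v. As x^(n+1) is trivial, `n + i` serves as i
        -- - 1, also for i = 0.
        step {inj₂ (inj₁ d)} {inj₁ w} (d<f , _ , w<d) (i , refl)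
          with VerticesOf.two ((x ^ suc j) ·e e) (v<xⁱ⁺¹e j) (·-<ᵉ (x ^ suc j) v<e) (xⁱv≢ j)
                 (subst (w <ᵉ_) (sym (trans (^-+-edge x (suc n) i e) (onE xⁿ≈id _))) w<d)
          where j = n + i
        ... | inj₁ eq = n + i , eq
        ... | inj₂ eq = suc (n + i) , eq
        step {inj₁ _} {inj₂ (inj₂ _)} _ _ = tt
        step {inj₂ (inj₁ _)} {inj₂ (inj₂ _)} _ _ = tt

    vertexRotation-order : ∀ {y q} .{{_ : NonZero q}} → VertexRotation v e f y → Σ E (v <ᵉ_) ↔ Fin q →
      y ^ q ≈ idA × (∀ i → y ^ i ≈ idA → q ∣ i)
    vertexRotation-order {y} {q} rot size = orbit-order (λ n → y ^ n ≈ idA) (λ i → index (v<yⁱe i)) period return onto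
      where
      open VertexRotation rot
      open FiniteSubset {R = v <ᵉ_} ≡true-irrelevant size
      yⁱv : ∀ i → (y ^ i) ·v v ≡ v
      yⁱv = ^-fixes-vertex y yv≡v
      v<yⁱe : ∀ i → v <ᵉ (y ^ i) ·e e
      v<yⁱe i = subst (_<ᵉ (y ^ i) ·e e) (yⁱv i) (·-<ᵉ (y ^ i) v<e)
      period : ∀ n i → y ^ n ≈ idA → index (v<yⁱe (n + i)) ≡ index (v<yⁱe i)
      period n i yⁿ≈id = index-cong (trans (^-+-edge y n i e) (onE yⁿ≈id _))
      return : ∀ i d → index (v<yⁱe (i + d)) ≡ index (v<yⁱe i) → y ^ d ≈ idA
      return i d eq = fixes-flag⇒≈id (y ^ d) v<e e<f (yⁱv d , yᵈe , fixes-face (y ^ d) v<e e<f (yⁱv d) yᵈe)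
        where
        yᵈe : (y ^ d) ·e e ≡ e
        yᵈe = ·e-injective (y ^ i) (trans (sym (^-+-edge y i d e)) (index-injective eq))
      onto : ∀ n → y ^ suc n ≈ idA → ∀ k → ∃ λ i → index (v<yⁱe i) ≡ k
      onto n yⁿ≈id k =
        let d , v<d = Inverse.from size k
            i , d≡ = fold-Star Q step (vertex-strongly-connected v (inj₂ (inj₁ e)) (inj₂ (inj₁ d)) v<e v<d) (0 , refl)
        in i , trans (index-cong (sym d≡)) (Inverse.strictlyInverseˡ size k)
        where
        Q : El → Set
        Q (inj₁ _) = ⊤
        Q (inj₂ (inj₁ d)) = ∃ λ i → d ≡ (y ^ i) ·e e
        Q (inj₂ (inj₂ g)) = ∃ λ i → g ≡ (y ^ i) ·f f
        e<yⁱ⁺¹f : ∀ i → (y ^ i) ·e e <ᶠ (y ^ suc i) ·f f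
        e<yⁱ⁺¹f i = subst ((y ^ i) ·e e <ᶠ_) (^-shift-face y i f) (·-<ᶠ (y ^ i) e<yf)
        yⁱe≢ : ∀ i → (y ^ i) ·e e ≢ (y ^ suc i) ·e e
        yⁱe≢ i eq = ye≢e (sym (·e-injective (y ^ i) (trans eq (sym (^-shift-edge y i e)))))
        yⁱf≢ : ∀ i → (y ^ i) ·f f ≢ (y ^ suc i) ·f f
        yⁱf≢ i eq = yf≢f (sym (·f-injective (y ^ i) (trans eq (sym (^-shift-face y i f)))))
        step : ∀ {a b} → Inc (inj₁ v) a × Inc (inj₁ v) b × Inc a b → Q a → Q b
        step {inj₂ (inj₁ d)} {inj₂ (inj₂ g)} (_ , _ , d<g) (i , refl)
          with FacesOf.two ((y ^ i) ·e e) (·-<ᶠ (y ^ i) e<f) (e<yⁱ⁺¹f i) (yⁱf≢ i) d<g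
        ... | inj₁ eq = i , eq
        ... | inj₂ eq = suc i , eq
        step {inj₂ (inj₂ g)} {inj₂ (inj₁ d)} (_ , v<d , d<g) (i , refl)
          with EdgesBetween.two v<d d<g′ (v<yⁱe j , e<yⁱ⁺¹f j) (v<yⁱe (suc j) , ·-<ᶠ (y ^ suc j) e<f) (yⁱe≢ j) (v<d , d<g′)
          where
          j = n + i
          d<g′ : d <ᶠ (y ^ suc j) ·f f
          d<g′ = subst (d <ᶠ_) (sym (trans (^-+-face y (suc n) i f) (onF yⁿ≈id _))) d<g
        ... | inj₁ eq = n + i , eq
        ... | inj₂ eq = suc (n + i) , eq
        step {_} {inj₁ _} _ _ = tt

-- From core-freeness to `TrivialCore`.

module RotationCore (P : Polyhedron) where
  open Polyhedron P
  open Automorphisms P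
  open Powers autMonoid

  powℕ≡^ : ∀ α n → powℕ α n ≡ α ^ n
  powℕ≡^ α zero = refl
  powℕ≡^ α (suc n) = cong (α ∘A_) (powℕ≡^ α n)

  coreFree⇒member≈id : ∀ {y} → CoreFree (Cyclic y) → (S : NormalSubgroupOf⟨_⟩ {autMonoid} y) →
    ∀ α → NormalSubgroupOf⟨_⟩.Member S α → α ≋ idA
  coreFree⇒member≈id {y} coreFree S α member = ≈A⇒≋ (coreFree Member
    (record
      { resp = λ α β α≈β → resp {α} {β} (≈A⇒≋ α≈β)
      ; has-id = ε-closed
      ; closed-∘ = λ α β → ∙-closed {α} {β}
      ; closed-inv = λ α → inverse-closed {α} {invA α} (invA-inverseˡ α) (invA-inverseʳ α)
      ; normal = λ g α → conjugate-closed {g} {invA g} {α} (invA-inverseʳ g) })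
    (λ α member → let n , α≈ = member⇒power {α} member in ℤ.+ n , ≋⇒≈A (subst (α ≋_) (sym (powℕ≡^ y n)) α≈))
    α member)
    where open NormalSubgroupOf⟨_⟩ S

  -- The generator y^m of the core lies in a normal subgroup inside ⟨y⟩, so it is trivial and `q`
  -- divides `m`.
  coreFree⇒trivialCore : ∀ {x y p q} .{{_ : NonZero p}} .{{_ : NonZero q}} → TightPair autMonoid x y p q →
    CoreFree (Cyclic y) → TrivialCore autMonoid x y q
  coreFree⇒trivialCore {y = y} T coreFree n b eq =
    let S , yᵐ∈S = coreSubgroup T core
    in ∣-trans (y^j≈ε⇒q∣j (Core.m core) (coreFree⇒member≈id coreFree S (y ^ Core.m core) yᵐ∈S)) (Core.largest core n b eq)
    where open TightPairProperties T

-- The rotation group of a tight polyhedron as an exact product.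

module TightRotations (P : Polyhedron) (chiral : Chiral P) {v e f}
  (v<e : Automorphisms._<ᵉ_ P v e) (e<f : Automorphisms._<ᶠ_ P e f) {x y : Polyhedron.Aut P}
  (rotX : ChiralAction.FaceRotation P chiral v e f x) (rotY : ChiralAction.VertexRotation P chiral v e f y)
  {p q : ℕ} .{{_ : NonZero p}} .{{_ : NonZero q}} (type : HasType P p q) (tight : Tight P p q) where
  open Polyhedron P
  open Automorphisms P
  open ChiralAction P chiral
  open FaceRotation rotX
  open VertexRotation rotY
  open Monoid autMonoid using (_≈_; _∙_; ∙-congʳ; identityˡ) renaming (trans to ≈-trans; sym to ≈-sym)
  open Powers autMonoid

  x-order = faceRotation-order v<e e<f rotX (proj₁ type f)
  y-order = vertexRotation-order v<e e<f rotY (proj₂ type v)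

  -- x^i fixes `f`, and it fixes `v` because y^j does. By chirality it fixes the base flag, so it is
  -- trivial, and y^j with it.
  independent : ∀ i j → x ^ i ∙ y ^ j ≈ idA → p ∣ i × q ∣ j
  independent i j eq = proj₂ x-order i xⁱ≈id , proj₂ y-order j (≈-trans (≈-sym (≈-trans (∙-congʳ xⁱ≈id) (identityˡ _))) eq)
    where
    xⁱf : (x ^ i) ·f f ≡ f
    xⁱf = ^-fixes-face x xf≡f i
    xⁱv : (x ^ i) ·v v ≡ v
    xⁱv = trans (cong ((x ^ i) ·v_) (sym (^-fixes-vertex y yv≡v j))) (onV eq v)
    xⁱ≈id : x ^ i ≈ idA
    xⁱ≈id = fixes-flag⇒≈id (x ^ i) v<e e<f (xⁱv , fixes-edge (x ^ i) v<e e<f xⁱv xⁱf , xⁱf)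

  -- yx sends the base flag to (Φ²)⁰, a half-turn about the base edge.
  involution : (y ∙ x) ∙ (y ∙ x) ≈ idA
  involution = fixes-flag⇒≈id (u ∙ u) v<e e<f (uuv , uue , fixes-face (u ∙ u) v<e e<f uuv uue)
    where
    u = y ∘A x
    v<ue : v <ᵉ u ·e e
    v<ue = subst (_<ᵉ u ·e e) yv≡v (·-<ᵉ y v<xe)
    ue<yf : u ·e e <ᶠ y ·f f
    ue<yf = subst (λ g → u ·e e <ᶠ y ·f g) xf≡f (·-<ᶠ u e<f)
    v<ye : v <ᵉ y ·e e
    v<ye = subst (_<ᵉ y ·e e) yv≡v (·-<ᵉ y v<e)
    -- At `v` the face `y ·f f` has the edges `e` and `y ·e e`. The image of `e` under yx is one of
    -- them, and not the latter since `x` moves `e`.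
    ue : u ·e e ≡ e
    ue with EdgesBetween.two v<e e<yf (v<e , e<yf) (v<ye , ·-<ᶠ y e<f) (λ eq → ye≢e (sym eq)) (v<ue , ue<yf)
    ... | inj₁ eq = eq
    ... | inj₂ eq = ⊥-elim (xe≢e (·e-injective y eq))
    uv≢v : u ·v v ≢ v
    uv≢v uv = yf≢f (trans (cong (y ·f_) (sym xf≡f)) (fixes-face u v<e e<f uv ue))
    u-<ᵉ : ∀ {w} → w <ᵉ e → u ·v w <ᵉ e
    u-<ᵉ {w} w<e = subst (u ·v w <ᵉ_) ue (·-<ᵉ u w<e)
    uue : (u ∙ u) ·e e ≡ e
    uue = trans (cong (u ·e_) ue) ue
    uuv : (u ∙ u) ·v v ≡ v
    uuv with VerticesOf.two e v<e (u-<ᵉ v<e) (λ eq → uv≢v (sym eq)) (u-<ᵉ (u-<ᵉ v<e))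
    ... | inj₁ eq = eq
    ... | inj₂ eq = ⊥-elim (uv≢v (·v-injective u eq))

  base : Fin 2 → Flag
  base Fin.zero = (v , e , f) , v<e , e<f
  base (Fin.suc Fin.zero) = (v , e , y ·f f) , v<e , e<yf

  class-base-≢ : class (base Fin.zero) ≢ class (base (Fin.suc Fin.zero))
  class-base-≢ = adjacent⇒class≢ (Fin.suc (Fin.suc Fin.zero)) _ _ (refl , refl , λ eq → yf≢f (sym eq))

  class-base-injective : ∀ s s′ → class (base s) ≡ class (base s′) → s ≡ s′
  class-base-injective Fin.zero Fin.zero _ = refl
  class-base-injective Fin.zero (Fin.suc Fin.zero) eq = ⊥-elim (class-base-≢ eq)
  class-base-injective (Fin.suc Fin.zero) Fin.zero eq = ⊥-elim (class-base-≢ (sym eq))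
  class-base-injective (Fin.suc Fin.zero) (Fin.suc Fin.zero) _ = refl

  -- By tightness the 2pq flags x^i y^j Φ and x^i y^j Φ² are all flags.
  place : Fin 2 → Fin p → Fin q → Flag
  place s i j = act (x ^ toℕ i ∙ y ^ toℕ j) (base s)

  class-place : ∀ s i j → class (place s i j) ≡ class (base s)
  class-place s i j = class-invariant (x ^ toℕ i ∙ y ^ toℕ j) (base s)

  place-injective : ∀ s i j s′ i′ j′ → place s i j ≡ place s′ i′ j′ → s ≡ s′ × i ≡ i′ × j ≡ j′
  place-injective s i j s′ i′ j′ eq with class-base-injective s s′
    (trans (sym (class-place s i j)) (trans (cong class eq) (class-place s′ i′ j′)))
  ... | refl =
    let i≡ , j≡ = normalForm-unique (proj₁ x-order) (proj₁ y-order) independent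
                    (toℕ i) (toℕ j) (toℕ i′) (toℕ j′) (act-free (x ^ toℕ i ∙ y ^ toℕ j) (x ^ toℕ i′ ∙ y ^ toℕ j′) (base s) eq)
    in refl , below i i′ i≡ , below j j′ j≡
    where
    below : ∀ {n} .{{_ : NonZero n}} (i i′ : Fin n) → toℕ i % n ≡ toℕ i′ % n → i ≡ i′
    below i i′ eq = toℕ-injective (trans (sym (m<n⇒m%n≡m (toℕ<n i))) (trans eq (m<n⇒m%n≡m (toℕ<n i′))))

  placeAt : Fin 2 × Fin p × Fin q → Flag
  placeAt (s , i , j) = place s i j

  placeAt-injective : ∀ t t′ → placeAt t ≡ placeAt t′ → t ≡ t′
  placeAt-injective (s , i , j) (s′ , i′ , j′) eq with place-injective s i j s′ i′ j′ eq
  ... | refl , refl , refl = refl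

  placeAt-surjective : ∀ Ψ → ∃ λ t → placeAt t ≡ Ψ
  placeAt-surjective = triples-injective⇒surjective tight placeAt placeAt-injective

  -- Automorphisms preserve classes, so the image of the base flag Φ is never some x^i y^j Φ²;
  -- freeness then identifies `α`.
  place≡act⇒≈ : ∀ α s i j → place s i j ≡ act α (base Fin.zero) → α ≈ x ^ toℕ i ∙ y ^ toℕ j
  place≡act⇒≈ α Fin.zero i j eq = act-free α (x ^ toℕ i ∙ y ^ toℕ j) (base Fin.zero) (sym eq)
  place≡act⇒≈ α (Fin.suc Fin.zero) i j eq = ⊥-elim (class-base-≢ (trans (sym (class-invariant α (base Fin.zero)))
    (trans (cong class (sym eq)) (class-place (Fin.suc Fin.zero) i j))))

  generated : ∀ α → ∃₂ λ i j → α ≈ x ^ i ∙ y ^ j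
  generated α = let (s , i , j) , eq = placeAt-surjective (act α (base Fin.zero))
                in toℕ i , toℕ j , place≡act⇒≈ α s i j eq

  tightPair : TightPair autMonoid x y p q
  tightPair = record
    { xᵖ≈ε = proj₁ x-order ; y^q≈ε = proj₁ y-order ; involution = involution
    ; generated = generated ; independent = independent }

  yx≉id : ¬ (y ∙ x ≈ idA)
  yx≉id yx≈id = yf≢f (trans (cong (y ·f_) (sym xf≡f)) (onF yx≈id f))

-- Divisibility for tight chiral polyhedra.

theorem5p1 : (P : Polyhedron) (p q : ℕ) → HasType P p q → Tight P p q
    → Chiral P → Odd q
    → ((2 ∣ p) × (p ∣ 2 * q))
    × (∀ (Φ : Polyhedron.Flag P) (σ₁ σ₂ : Polyhedron.Aut P)
    → IsSigma1 P Φ σ₁ → IsSigma2 P Φ σ₂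
    → Polyhedron.CoreFree P (Polyhedron.Cyclic P σ₂)
    → p ≡ 2 * q)
theorem5p1 P p q type tight chiral odd =
  divisibility (2 * p * q) refl , λ Φ σ₁ σ₂ s₁ s₂ → proj₂ (conclusion Φ σ₁ σ₂ s₁ s₂)
  where
  open Polyhedron P
  open Automorphisms P
  open ChiralAction P chiral

  p≢0 : Flag → NonZero p
  p≢0 ((_ , e , f) , _ , e<f) = Fin.nonZeroIndex (Inverse.to (proj₁ type f) (e , e<f))

  q≢0 : Flag → NonZero q
  q≢0 ((v , e , _) , v<e , _) = Fin.nonZeroIndex (Inverse.to (proj₂ type v) (e , v<e))

  faceRotation : ∀ Φ σ → IsSigma1 P Φ σ → FaceRotation (fv Φ) (fe Φ) (ff Φ) σ
  faceRotation Φ σ ((_ , v<e₁ , _) , _ , (refl , e≢e₁ , refl) , (v≢v₁ , refl , refl) , (refl , refl , σf)) =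
    record { xf≡f = σf ; v<xe = v<e₁ ; xe≢e = e≢e₁ ∘ sym ; xv≢v = v≢v₁ ∘ sym }

  vertexRotation : ∀ Φ σ → IsSigma2 P Φ σ → VertexRotation (fv Φ) (fe Φ) (ff Φ) σ
  vertexRotation Φ σ ((_ , _ , e<f₁) , _ , (refl , refl , f≢f₁) , (refl , e≢e₁ , refl) , (σv , refl , refl)) =
    record { yv≡v = σv ; e<yf = e<f₁ ; ye≢e = e≢e₁ ∘ sym ; yf≢f = f≢f₁ ∘ sym }

  conclusion : ∀ Φ σ₁ σ₂ → IsSigma1 P Φ σ₁ → IsSigma2 P Φ σ₂ →
    (2 ∣ p × p ∣ 2 * q) × (CoreFree (Cyclic σ₂) → p ≡ 2 * q)
  conclusion Φ@(_ , v<e , e<f) σ₁ σ₂ s₁ s₂ =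
    let p∣2q , coreFree-case = twiceDivisor (suc (p + q)) ≤-refl odd even tightPair
    in (even , p∣2q) , λ coreFree → coreFree-case (RotationCore.coreFree⇒trivialCore P tightPair coreFree)
    where
    instance
      p-nonZero : NonZero p
      p-nonZero = p≢0 Φ
      q-nonZero : NonZero q
      q-nonZero = q≢0 Φ
    open TightRotations P chiral v<e e<f (faceRotation Φ σ₁ s₁) (vertexRotation Φ σ₂ s₂) type tight
    even : 2 ∣ p
    even = TightPairProperties.2∣p tightPair odd yx≉id

  -- The first conclusion mentions no generators, so they have to be produced: (Φ¹)⁰ is two
  -- adjacencies away from `Φ`, hence in the same class.
  sigma1-exists : ∀ Φ → ∃ (IsSigma1 P Φ)
  sigma1-exists Φ@((v , e , f) , v<e , e<f) =
    let e₁ , (v<e₁ , e₁<f) , e≢e₁ = EdgesBetween.other v<e e<f (v<e , e<f)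
        v₁ , v₁<e₁ , v≢v₁ = VerticesOf.other e₁ v<e₁
        Φ₁ = (v , e₁ , f) , v<e₁ , e₁<f
        Φ₁₀ = (v₁ , e₁ , f) , v₁<e₁ , e₁<f
        adj₁ = refl , e≢e₁ , refl
        adj₀ = v≢v₁ , refl , refl
        σ , σΦ = class-transitive Φ Φ₁₀ (≢-≢⇒≡ (adjacent⇒class≢ (Fin.suc Fin.zero) Φ Φ₁ adj₁)
                                              (adjacent⇒class≢ Fin.zero Φ₁ Φ₁₀ adj₀ ∘ sym))
    in σ , Φ₁ , Φ₁₀ , adj₁ , adj₀ , cong fv σΦ , cong fe σΦ , cong ff σΦ

  sigma2-exists : ∀ Φ → ∃ (IsSigma2 P Φ)
  sigma2-exists Φ@((v , e , f) , v<e , e<f) =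
    let f₂ , e<f₂ , f≢f₂ = FacesOf.other e e<f
        e₂ , (v<e₂ , e₂<f₂) , e≢e₂ = EdgesBetween.other v<e e<f₂ (v<e , e<f₂)
        Φ₂ = (v , e , f₂) , v<e , e<f₂
        Φ₂₁ = (v , e₂ , f₂) , v<e₂ , e₂<f₂
        adj₂ = refl , refl , f≢f₂
        adj₁ = refl , e≢e₂ , refl
        σ , σΦ = class-transitive Φ Φ₂₁ (≢-≢⇒≡ (adjacent⇒class≢ (Fin.suc (Fin.suc Fin.zero)) Φ Φ₂ adj₂)
                                              (adjacent⇒class≢ (Fin.suc Fin.zero) Φ₂ Φ₂₁ adj₁ ∘ sym))
    in σ , Φ₂ , Φ₂₁ , adj₂ , adj₁ , cong fv σΦ , cong fe σΦ , cong ff σΦ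

  -- A base flag exists because without flags the group would be vacuously transitive on them,
  -- against chirality.
  divisibility : ∀ n → 2 * p * q ≡ n → 2 ∣ p × p ∣ 2 * q
  divisibility zero n≡0 = ⊥-elim (proj₂ (proj₂ (proj₂ chiral)) λ Φ _ →
    ⊥-elim (Fin.¬Fin0 (subst Fin n≡0 (Inverse.to tight Φ))))
  divisibility (suc n) n≡ =
    let Φ = Inverse.from tight (subst Fin (sym n≡) Fin.zero)
        σ₁ , s₁ = sigma1-exists Φ
        σ₂ , s₂ = sigma2-exists Φ
    in proj₁ (conclusion Φ σ₁ σ₂ s₁ s₂)
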